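{- For every integer $n\ge0$ (with the convention $0^0=1$), $$\sum_{m\ge0}\frac{m^n}{n+1}\binom{m+n}{m}t^m=\frac{\overline{Q}_n(t)}{(1-t)^{2n+1}},$$ where $\overline{Q}_n(t)=\sum_{\pi\in\overline{\mathcal{Q}}_n}t^{\operatorname{des}(\pi)}$.
   Context: For a sequence $\pi=\pi_1\cdots\pi_r$ of positive integers, $i\in\{1,\dots,r\}$ is a descent if $\pi_i>\pi_{i+1}$ or $i=r$; $\operatorname{des}(\pi)$ is the number of descents. $\overline{\mathcal{Q}}_n$ is the set of quasi-Stirling permutations: permutations $\pi_1\cdots\pi_{2n}$ of the multiset $\{1,1,\dots,n,n\}$ with no indices $i<j<k<\ell$ such that $\pi_i=\pi_k$ and $\pi_j=\pi_\ell$. -}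

module Defs where

open import Data.Nat as ℕ using (ℕ; zero; suc; _+_; _*_; _∸_; _^_; _≡ᵇ_; _<ᵇ_)
open import Data.Nat.Combinatorics using (_C_)
open import Data.Bool using (Bool; true; false; _∧_; not; if_then_else_)
open import Data.List using (List; []; _∷_; length; map; filterᵇ; upTo; concatMap; foldr)
open import Data.Bool.ListAction using (any)
open import Data.Integer using (+_)
open import Data.Rational using (ℚ; _/_; 0ℚ; 1ℚ; -_) renaming (_+_ to _+ℚ_; _*_ to _*ℚ_)
open import Relation.Binary.PropositionalEquality using (_≡_)

words : ℕ → ℕ → List (List ℕ)
words n zero    = [] ∷ []
words n (suc L) = concatMap (λ v → map (v ∷_) (words n L)) (map suc (upTo n))

count : ℕ → List ℕ → ℕ
count v []      = 0
count v (x ∷ w) = (if v ≡ᵇ x then 1 else 0) + count v w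

isMultisetPerm : ℕ → List ℕ → Bool
isMultisetPerm n w =
  (length w ≡ᵇ 2 * n) ∧ foldr (λ v b → (count v w ≡ᵇ 2) ∧ b) true (map suc (upTo n))

-- 0-indexed entry (default 0 out of range; only used in range)
at : List ℕ → ℕ → ℕ
at []      _       = 0
at (x ∷ w) zero    = x
at (x ∷ w) (suc i) = at w i

anyBelow : ℕ → (ℕ → Bool) → Bool
anyBelow n f = any f (upTo n)

hasPattern : List ℕ → Bool
hasPattern w =
  anyBelow (length w) λ l → anyBelow l λ k → anyBelow k λ j → anyBelow j λ i →
    (at w i ≡ᵇ at w k) ∧ (at w j ≡ᵇ at w l)

-- the set of quasi-Stirling permutations of {1,1,…,n,n} (as a duplicate-free list)
quasiStirling : ℕ → List (List ℕ)
quasiStirling n = filterᵇ (λ w → isMultisetPerm n w ∧ not (hasPattern w)) (words n (2 * n))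

-- descents: i with π_i > π_{i+1}, or i = r (the last position)
des : List ℕ → ℕ
des []          = 0
des (x ∷ [])    = 1
des (x ∷ y ∷ w) = (if y <ᵇ x then 1 else 0) + des (y ∷ w)

Series : Set
Series = ℕ → ℚ

sumBelow : ℕ → (ℕ → ℚ) → ℚ
sumBelow zero    f = 0ℚ
sumBelow (suc n) f = sumBelow n f +ℚ f n

_⊛_ : Series → Series → Series
(f ⊛ g) k = sumBelow (suc k) (λ i → f i *ℚ g (k ∸ i))

oneS : Series
oneS zero = 1ℚ
oneS (suc _) = 0ℚ

oneMinusT : Series
oneMinusT zero          = 1ℚ
oneMinusT (suc zero)    = - 1ℚ
oneMinusT (suc (suc _)) = 0ℚ

_^S_ : Series → ℕ → Series
f ^S zero  = oneS
f ^S suc e = f ⊛ (f ^S e)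

Qbar : ℕ → Series
Qbar n k = (+ length (filterᵇ (λ w → des w ≡ᵇ k) (quasiStirling n))) / 1

-- Σ_{m≥0} m^n/(n+1) binom(m+n, m) t^m   (Agda's 0 ^ 0 = 1)
lhsSeries : ℕ → Series
lhsSeries n m = (+ (m ^ n * ((m + n) C m))) / suc n

{-# OPTIONS --safe #-}
module Submission where

-- Removing the smallest letter x from a quasi-Stirling permutation, π = U x V x W, leaves two
-- independent ones, V and UW.  Among the positions where x V x can be inserted into z = UW, exactly
-- des z create no new descent and all others create one.  Hence, with θ = t d/dt, the normalised
-- generating function u(x, t) = Σ Q̄ₙ(t) / (1-t)^(2n+1) xⁿ/n! solves the inviscid Burgers equation
-- ∂u/∂x = u θu with u(0, t) = 1/(1-t).  Its powers obey (k+1) ∂(uᵏ)/∂x = k θ(uᵏ⁺¹), so that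
-- (n+1) ∂ⁿu/∂xⁿ = θⁿ uⁿ⁺¹, and at x = 0 the right-hand side is Σₘ mⁿ C(m+n,m) tᵐ.

open import Algebra.Bundles using (CommutativeRing)
import Algebra.Properties.CommutativeMonoid.Mult
import Algebra.Properties.Group
import Algebra.Properties.Semiring.Exp
import Algebra.Properties.Semiring.Mult
import Algebra.Solver.Ring.NaturalCoefficients.Default
open import Data.Bool using (Bool; true; false; if_then_else_; not; _∧_; T)
open import Data.Bool.Properties using (T-∧; T?)
open import Data.Empty using (⊥)
import Data.Integer as ℤ
import Data.Integer.Properties as ℤ
open import Data.List using (List; []; _∷_; _++_; map; concatMap; length; upTo; filterᵇ; foldr)
open import Data.List.Properties using (∷-injective; ∷-injectiveˡ; ∷-injectiveʳ; length-++; ++-assoc; length-map; length-upTo; map-∘)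
open import Data.List.Membership.Propositional using (_∈_; _∉_; find; lose)
open import Data.List.Membership.Propositional.Properties
open import Data.List.Membership.Propositional.Properties.WithK using (unique∧set⇒bag)
open import Data.List.Relation.Binary.BagAndSetEquality using (∼bag⇒↭)
open import Data.List.Relation.Binary.Permutation.Propositional using (_↭_)
open import Data.List.Relation.Binary.Permutation.Propositional.Properties using (↭-length; filter-↭)
open import Data.List.Relation.Binary.Sublist.Propositional using (_⊆_; []; _∷_; _∷ʳ_; minimum; from∈; to∈; ⊆-refl; ⊆-trans)
open import Data.List.Relation.Binary.Sublist.Propositional.Properties using (All-resp-⊆; Any-resp-⊆; length-mono-≤; ++⁺; ++⁺ˡ; ++⁺ʳ; ∷ˡ⁻; ∷⁻)
open import Data.List.Relation.Ternary.Interleaving using (_∷ˡ_; _∷ʳ_)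
open import Data.List.Relation.Ternary.Interleaving.Propositional using (Interleaving; [])
open import Data.List.Relation.Unary.All as All using (All; []; _∷_)
import Data.List.Relation.Unary.All.Properties as All
open import Data.List.Relation.Unary.AllPairs as AllPairs using (AllPairs; []; _∷_)
import Data.List.Relation.Unary.AllPairs.Properties as AllPairs
open import Data.List.Relation.Unary.Any using (here; there)
open import Data.List.Relation.Unary.Any.Properties using (any⁺; any⁻)
open import Data.List.Relation.Unary.Unique.Propositional using (Unique)
import Data.List.Relation.Unary.Unique.Propositional.Properties as Unique
open import Data.Nat using (zero; suc; _≤_; _<_; z≤n; s≤s; _≡ᵇ_; _<ᵇ_; _≟_) renaming (_+_ to _ℕ+_; _*_ to _ℕ*_; _^_ to _ℕ^_)
open import Data.Nat.Combinatorics using (_C_; nCk+nC[k+1]≡[n+1]C[k+1]; nCn≡1)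
import Data.Nat.Properties as ℕ
open import Data.Nat.Solver using (module +-*-Solver)
open import Data.Product using (∃; ∃₂; _×_; _,_; proj₁; proj₂; map₁; map₂)
open import Data.Rational using (_/_; 0ℚ; 1ℚ; fromℚᵘ)
import Data.Rational.Properties as ℚ
import Data.Rational.Unnormalised as ℚᵘ
import Data.Rational.Unnormalised.Properties as ℚᵘ
open import Data.Sum using (inj₁; inj₂; [_,_]′)
open import Data.Unit using (tt)
open import Function using (_∘_)
open import Function.Bundles using (Equivalence; mk⇔)
open import Level using (_⊔_)
import Relation.Binary.PropositionalEquality as ≡
import Relation.Binary.Reasoning.Setoid
open import Relation.Nullary using (¬_; Dec; yes; no; contradiction)
open import Relation.Nullary.Negation using (contraposition)

open import Defs
open import Data.Nat using (ℕ)
open import Relation.Binary.PropositionalEquality using (_≡_)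

-- Quasi-Stirling words

-- The letters of V can form any subset of the letters other than x, so the recursion leaves the
-- alphabet 1, ..., n. The words are therefore enumerated over arbitrary sorted lists of letters,
-- and the free choice of the subset is what makes the generating function in x exponential. That
-- only the number of letters matters is drawn from the recursion itself, without relabelling words.
--
-- The exponent 2n+1 comes from the number of insertion positions. If b = Σ t^des(z) over words z of
-- common length l, each z has l+1 of them, and the insertions contribute (1-t) θb + (l+1) t b,
-- which is (1-t)^(l+2) θ(b / (1-t)^(l+1)). With l = 2m this turns the recursion into a product of
-- normalised terms.
--
-- The formula for ∂ⁿu is Lagrange inversion for the implicit solution of the Burgers equation; the
-- identity for powers replaces the inversion by an induction. In the descent counts, 1/(1-t) enters
-- only as an element g with g = 1 + t g, and negative terms are moved to the other side.

module Words where
  open import Data.Nat using (_+_; _*_)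
  open import Data.Nat.Properties
  open ≡ using (_≢_; refl; sym; trans; cong; cong₂; subst; subst₂; module ≡-Reasoning)
  open import Data.List.Membership.DecPropositional _≟_ using (_∈?_)
  open +-*-Solver using (solve; _:+_; _:*_; _:=_; con)

  -- Counting letters

  δ : ℕ → ℕ → ℕ
  δ v x = if v ≡ᵇ x then 1 else 0

  δ-refl : ∀ v → δ v v ≡ 1
  δ-refl zero    = refl
  δ-refl (suc v) = δ-refl v

  δ-≢ : ∀ {v x} → v ≢ x → δ v x ≡ 0
  δ-≢ {zero}  {zero}  v≢x = contradiction refl v≢x
  δ-≢ {zero}  {suc x} v≢x = refl
  δ-≢ {suc v} {zero}  v≢x = refl
  δ-≢ {suc v} {suc x} v≢x = δ-≢ (v≢x ∘ cong suc)

  count-++ : ∀ v xs ys → count v (xs ++ ys) ≡ count v xs + count v ys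
  count-++ v []       ys = refl
  count-++ v (x ∷ xs) ys = trans (cong (δ v x +_) (count-++ v xs ys)) (sym (+-assoc (δ v x) _ _))

  count-∉ : ∀ {v} xs → v ∉ xs → count v xs ≡ 0
  count-∉ []       v∉ = refl
  count-∉ (x ∷ xs) v∉ = cong₂ _+_ (δ-≢ (v∉ ∘ here)) (count-∉ xs (v∉ ∘ there))

  count-∈ : ∀ {v xs} → v ∈ xs → count v xs ≢ 0
  count-∈ {v} (here refl) eq rewrite δ-refl v with () ← eq
  count-∈ {v} {x ∷ xs} (there v∈) eq = count-∈ v∈ (m+n≡0⇒n≡0 (δ v x) eq)

  count-unique : ∀ {v xs} → Unique xs → v ∈ xs → count v xs ≡ 1
  count-unique {v} {x ∷ xs} uq@(_ ∷ _) (here refl) =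
    cong₂ _+_ (δ-refl v) (count-∉ xs (Unique.Unique[x∷xs]⇒x∉xs uq))
  count-unique {v} {x ∷ xs} (x≢ ∷ uq) (there v∈) =
    cong₂ _+_ (δ-≢ {v} {x} (λ { refl → All.lookup x≢ v∈ refl })) (count-unique uq v∈)

  count≡0⇒∉ : ∀ {v xs} → count v xs ≡ 0 → v ∉ xs
  count≡0⇒∉ eq v∈ = count-∈ v∈ eq

  count≢0⇒∈ : ∀ v xs → count v xs ≢ 0 → v ∈ xs
  count≢0⇒∈ v []       c = contradiction refl c
  count≢0⇒∈ v (x ∷ xs) c with v ≟ x
  ... | yes refl = here refl
  ... | no v≢x   = there (count≢0⇒∈ v xs (λ eq → c (cong₂ _+_ (δ-≢ v≢x) eq)))

  firstOccurrence : ∀ {c} x w → count x w ≡ suc c →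
    ∃₂ λ U R → w ≡ U ++ x ∷ R × count x U ≡ 0 × count x R ≡ c
  firstOccurrence x (y ∷ w) eq with x ≟ y
  ... | yes refl = [] , w , refl , refl , suc-injective (trans (cong (_+ count x w) (sym (δ-refl x))) eq)
  ... | no x≢y with U , R , refl , p , q ← firstOccurrence x w (trans (cong (_+ count x w) (sym (δ-≢ x≢y))) eq)
      = y ∷ U , R , refl , cong₂ _+_ (δ-≢ x≢y) p , q

  firstOccurrence-unique : ∀ {x : ℕ} U U′ {R R′} → x ∉ U → x ∉ U′ →
    U ++ x ∷ R ≡ U′ ++ x ∷ R′ → U ≡ U′ × R ≡ R′
  firstOccurrence-unique []      []       _  _   eq = refl , ∷-injectiveʳ eq
  firstOccurrence-unique []      (_ ∷ _)  _  x∉′ eq = contradiction (here (∷-injectiveˡ eq)) x∉′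
  firstOccurrence-unique (_ ∷ _) []       x∉ _   eq = contradiction (here (sym (∷-injectiveˡ eq))) x∉
  firstOccurrence-unique (u ∷ U) (u′ ∷ U′) x∉ x∉′ eq with refl , eq′ ← ∷-injective eq
    with refl , R≡ ← firstOccurrence-unique U U′ (x∉ ∘ there) (x∉′ ∘ there) eq′ = refl , R≡

  module _ {A B : Set} where

    concatMap-∈⁺ : ∀ (f : A → List B) {x xs y} → x ∈ xs → y ∈ f x → y ∈ concatMap f xs
    concatMap-∈⁺ f x∈ y∈ = ∈-concatMap⁺ f (lose x∈ y∈)

    concatMap-∈⁻ : ∀ (f : A → List B) xs {y} → y ∈ concatMap f xs → ∃ λ x → x ∈ xs × y ∈ f x
    concatMap-∈⁻ f xs y∈ = find (∈-concatMap⁻ f {xs} y∈)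

    concatMap-unique : ∀ (f : A → List B) {xs} → Unique xs →
      (∀ {x} → x ∈ xs → Unique (f x)) →
      (∀ {x x′ y} → x ∈ xs → x′ ∈ xs → y ∈ f x → y ∈ f x′ → x ≡ x′) →
      Unique (concatMap f xs)
    concatMap-unique f []        each sep = []
    concatMap-unique f {x ∷ xs} (x≢ ∷ uq) each sep = Unique.++⁺ (each (here refl))
      (concatMap-unique f uq (each ∘ there) (λ p q → sep (there p) (there q)))
      λ (y∈ , y∈′) → let x′ , x′∈ , y∈fx′ = concatMap-∈⁻ f xs y∈′ in
        All.lookup x≢ x′∈ (sep (here refl) (there x′∈) y∈ y∈fx′)

  -- Distributing the letters over two alphabets

  splits : List ℕ → List (List ℕ × List ℕ)
  splits []       = ([] , []) ∷ []
  splits (x ∷ xs) = map (map₁ (x ∷_)) (splits xs) ++ map (map₂ (x ∷_)) (splits xs)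

  ∈-splits⁺ : ∀ {A B xs} → Interleaving A B xs → (A , B) ∈ splits xs
  ∈-splits⁺ []            = here refl
  ∈-splits⁺ (refl ∷ˡ int) = ∈-++⁺ˡ (∈-map⁺ _ (∈-splits⁺ int))
  ∈-splits⁺ {xs = x ∷ xs} (refl ∷ʳ int) = ∈-++⁺ʳ (map (map₁ (x ∷_)) (splits xs)) (∈-map⁺ _ (∈-splits⁺ int))

  ∈-splits⁻ : ∀ {A B} xs → (A , B) ∈ splits xs → Interleaving A B xs
  ∈-splits⁻ []       (here refl) = []
  ∈-splits⁻ (x ∷ xs) AB∈ with ∈-++⁻ (map (map₁ (x ∷_)) (splits xs)) AB∈
  ... | inj₁ p with _ , q , refl ← ∈-map⁻ _ p = refl ∷ˡ ∈-splits⁻ xs q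
  ... | inj₂ p with _ , q , refl ← ∈-map⁻ _ p = refl ∷ʳ ∈-splits⁻ xs q

  module _ where
    private variable
      A B xs : List ℕ

    interleaving-⊆ˡ : Interleaving A B xs → A ⊆ xs
    interleaving-⊆ˡ []            = []
    interleaving-⊆ˡ (refl ∷ˡ int) = refl ∷ interleaving-⊆ˡ int
    interleaving-⊆ˡ (refl ∷ʳ int) = _ ∷ʳ interleaving-⊆ˡ int

    interleaving-⊆ʳ : Interleaving A B xs → B ⊆ xs
    interleaving-⊆ʳ []            = []
    interleaving-⊆ʳ (refl ∷ˡ int) = _ ∷ʳ interleaving-⊆ʳ int
    interleaving-⊆ʳ (refl ∷ʳ int) = refl ∷ interleaving-⊆ʳ int

    interleaving-length : Interleaving A B xs → length A + length B ≡ length xs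
    interleaving-length []         = refl
    interleaving-length (_ ∷ˡ int) = cong suc (interleaving-length int)
    interleaving-length {A} {_ ∷ B} (_ ∷ʳ int) =
      trans (+-suc (length A) (length B)) (cong suc (interleaving-length int))

    interleaving-count : ∀ v → Interleaving A B xs → count v A + count v B ≡ count v xs
    interleaving-count v [] = refl
    interleaving-count {x ∷ A} {B} v (refl ∷ˡ int) =
      trans (+-assoc (δ v x) _ _) (cong (δ v x +_) (interleaving-count v int))
    interleaving-count {A} {x ∷ B} v (refl ∷ʳ int) = begin
      count v A + (δ v x + count v B) ≡⟨ +-assoc (count v A) _ _ ⟨
      count v A + δ v x + count v B   ≡⟨ cong (_+ count v B) (+-comm (count v A) _) ⟩
      δ v x + count v A + count v B   ≡⟨ +-assoc (δ v x) _ _ ⟩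
      δ v x + (count v A + count v B) ≡⟨ cong (δ v x +_) (interleaving-count v int) ⟩
      _ ∎ where open ≡-Reasoning

    -- Since letters do not repeat, the first one lies in the left part exactly when its count there
    -- is nonzero. `qs-unique` uses this to recover both alphabets from the word `V`.
    interleaving-unique : ∀ {A′ B′} → Unique xs → Interleaving A B xs → Interleaving A′ B′ xs →
      (∀ v → count v A ≡ count v A′) → A ≡ A′ × B ≡ B′
    interleaving-unique uq [] [] eq = refl , refl
    interleaving-unique (x≢ ∷ uq) (_∷ˡ_ {c = x} refl i) (refl ∷ˡ j) eq
      with refl , refl ← interleaving-unique uq i j (λ v → +-cancelˡ-≡ (δ v x) _ _ (eq v)) = refl , refl
    interleaving-unique (x≢ ∷ uq) (refl ∷ʳ i) (refl ∷ʳ j) eq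
      with refl , refl ← interleaving-unique uq i j eq = refl , refl
    interleaving-unique uq@(_ ∷ _) (_∷ˡ_ {c = x} {l = l} refl i) (refl ∷ʳ j) eq =
      contradiction (trans (eq x) (count-∉ _ (Unique.Unique[x∷xs]⇒x∉xs uq ∘ Any-resp-⊆ (interleaving-⊆ˡ j))))
        (count-∈ {x} {x ∷ l} (here refl))
    interleaving-unique uq@(_ ∷ _) (refl ∷ʳ i) (_∷ˡ_ {c = x} {l = l} refl j) eq =
      contradiction (trans (sym (eq x)) (count-∉ _ (Unique.Unique[x∷xs]⇒x∉xs uq ∘ Any-resp-⊆ (interleaving-⊆ˡ i))))
        (count-∈ {x} {x ∷ l} (here refl))

  splits-unique : ∀ {xs} → Unique xs → Unique (splits xs)
  splits-unique []        = [] ∷ []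
  splits-unique {x ∷ xs} uq₀@(_ ∷ uq) = Unique.++⁺
    (Unique.map⁺ (λ { refl → refl }) (splits-unique uq))
    (Unique.map⁺ (λ { refl → refl }) (splits-unique uq))
    λ (p , q) → disj (∈-map⁻ _ p) (∈-map⁻ _ q)
    where
    disj : ∀ {y} → (∃ λ a → a ∈ splits xs × y ≡ map₁ (x ∷_) a) → (∃ λ a → a ∈ splits xs × y ≡ map₂ (x ∷_) a) → ⊥
    disj (_ , _ , refl) (_ , q , refl) =
      Unique.Unique[x∷xs]⇒x∉xs uq₀ (Any-resp-⊆ (interleaving-⊆ˡ (∈-splits⁻ xs q)) (here refl))

  -- Specified through counts because `qs-complete` takes `p` to be occurrence in `V` and then
  -- compares nothing but counts.
  interleaveBy : (p : ℕ → Bool) (xs : List ℕ) → ∃₂ λ A B → Interleaving A B xs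
    × (∀ v → count v A ≡ (if p v then count v xs else 0))
    × (∀ v → count v B ≡ (if p v then 0 else count v xs))
  interleaveBy p [] = [] , [] , [] , (λ v → if-0 (p v)) , (λ v → if-0 (p v))
    where
    if-0 : ∀ b → 0 ≡ (if b then 0 else 0)
    if-0 true  = refl
    if-0 false = refl
  interleaveBy p (x ∷ xs) with A , B , int , cA , cB ← interleaveBy p xs with p x in px
  ... | true = x ∷ A , B , refl ∷ˡ int , inA , inB
    where
    inA : ∀ v → count v (x ∷ A) ≡ (if p v then count v (x ∷ xs) else 0)
    inA v with v ≟ x
    ... | yes refl rewrite cA v | px = refl
    ... | no v≢x rewrite cA v | δ-≢ v≢x = refl
    inB : ∀ v → count v B ≡ (if p v then 0 else count v (x ∷ xs))
    inB v with v ≟ x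
    ... | yes refl rewrite cB v | px = refl
    ... | no v≢x rewrite cB v | δ-≢ v≢x = refl
  ... | false = A , x ∷ B , refl ∷ʳ int , inA , inB
    where
    inA : ∀ v → count v A ≡ (if p v then count v (x ∷ xs) else 0)
    inA v with v ≟ x
    ... | yes refl rewrite cA v | px = refl
    ... | no v≢x rewrite cA v | δ-≢ v≢x = refl
    inB : ∀ v → count v (x ∷ B) ≡ (if p v then 0 else count v (x ∷ xs))
    inB v with v ≟ x
    ... | yes refl rewrite cB v | px = refl
    ... | no v≢x rewrite cB v | δ-≢ v≢x = refl

  -- Cutting a word and the recursive enumeration

  cuts : List ℕ → List (List ℕ × List ℕ)
  cuts []      = ([] , []) ∷ []
  cuts (c ∷ z) = ([] , c ∷ z) ∷ map (map₁ (c ∷_)) (cuts z)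

  ∈-cuts⁺ : ∀ U W → (U , W) ∈ cuts (U ++ W)
  ∈-cuts⁺ []      []      = here refl
  ∈-cuts⁺ []      (_ ∷ _) = here refl
  ∈-cuts⁺ (u ∷ U) W       = there (∈-map⁺ _ (∈-cuts⁺ U W))

  ∈-cuts⁻ : ∀ {U W} z → (U , W) ∈ cuts z → U ++ W ≡ z
  ∈-cuts⁻ []      (here refl) = refl
  ∈-cuts⁻ (c ∷ z) (here refl) = refl
  ∈-cuts⁻ (c ∷ z) (there p) with _ , q , refl ← ∈-map⁻ _ p = cong (c ∷_) (∈-cuts⁻ z q)

  cuts-unique : ∀ z → Unique (cuts z)
  cuts-unique []      = [] ∷ []
  cuts-unique (c ∷ z) = All.tabulate (λ p → sep (∈-map⁻ _ p)) ∷ Unique.map⁺ (λ { refl → refl }) (cuts-unique z)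
    where
    sep : ∀ {y} → (∃ λ a → a ∈ cuts z × y ≡ map₁ (c ∷_) a) → ([] , c ∷ z) ≢ y
    sep (_ , _ , refl) ()

  insertAround : ℕ → List ℕ → List ℕ × List ℕ → List ℕ
  insertAround x V (U , W) = U ++ x ∷ V ++ x ∷ W

  -- The first argument is fuel; any value ≥ length xs gives the full list.
  qs : ℕ → List ℕ → List (List ℕ)
  qs _       []       = [] ∷ []
  qs zero    (_ ∷ _)  = []
  qs (suc f) (x ∷ xs) =
    concatMap (λ (A , B) → concatMap (λ V → concatMap (λ z → map (insertAround x V) (cuts z)) (qs f B)) (qs f A)) (splits xs)

  allPairs-resp-⊆ : ∀ {R : ℕ → ℕ → Set} {xs ys} → xs ⊆ ys → AllPairs R ys → AllPairs R xs
  allPairs-resp-⊆ []         []         = []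
  allPairs-resp-⊆ (y ∷ʳ τ)   (_ ∷ ap)   = allPairs-resp-⊆ τ ap
  allPairs-resp-⊆ (refl ∷ τ) (ry ∷ ap)  = All-resp-⊆ τ ry ∷ allPairs-resp-⊆ τ ap

  Sorted : List ℕ → Set
  Sorted = AllPairs _<_

  sorted⇒unique : ∀ {xs} → Sorted xs → Unique xs
  sorted⇒unique = AllPairs.map <⇒≢

  -- As in `hasPattern`, `a` and `b` may coincide. With sublists instead of indices, prefixes and
  -- blocks of a word can be discarded without arithmetic.
  Crossing : List ℕ → Set
  Crossing w = ∃₂ λ a b → a ∷ b ∷ a ∷ b ∷ [] ⊆ w

  -- Since `twice` ranges over all `v`, it also excludes letters outside `xs`.
  record QuasiStirling (xs w : List ℕ) : Set where
    constructor _,_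
    field
      twice       : ∀ v → count v w ≡ 2 * count v xs
      noncrossing : ¬ Crossing w

  record Decomposition (f x : ℕ) (xs w : List ℕ) : Set where
    constructor decomposition
    field
      {A B V U W} : List ℕ
      int  : Interleaving A B xs
      V∈   : V ∈ qs f A
      UW∈  : U ++ W ∈ qs f B
      w≡   : w ≡ insertAround x V (U , W)

  ∈-qs⁺ : ∀ {f x xs w} → Decomposition f x xs w → w ∈ qs (suc f) (x ∷ xs)
  ∈-qs⁺ (decomposition {U = U} {W} int V∈ UW∈ refl) =
    concatMap-∈⁺ _ (∈-splits⁺ int) (concatMap-∈⁺ _ V∈ (concatMap-∈⁺ _ UW∈ (∈-map⁺ _ (∈-cuts⁺ U W))))

  ∈-qs⁻ : ∀ f x xs {w} → w ∈ qs (suc f) (x ∷ xs) → Decomposition f x xs w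
  ∈-qs⁻ f x xs w∈
    with (A , B) , AB∈ , w∈₁ ← concatMap-∈⁻ _ (splits xs) w∈
    with V , V∈ , w∈₂ ← concatMap-∈⁻ _ (qs f A) w∈₁
    with z , z∈ , w∈₃ ← concatMap-∈⁻ _ (qs f B) w∈₂
    with (U , W) , UW∈ , refl ← ∈-map⁻ _ w∈₃
    with refl ← ∈-cuts⁻ z UW∈ = decomposition (∈-splits⁻ xs AB∈) V∈ z∈ refl

  length-insertAround : ∀ x V U W → length (insertAround x V (U , W)) ≡ 2 + (length V + length (U ++ W))
  length-insertAround x V U W
    rewrite length-++ U {x ∷ V ++ x ∷ W} | length-++ V {x ∷ W} | length-++ U {W} =
    solve 3 (λ u v w → u :+ (con 1 :+ (v :+ (con 1 :+ w))) := con 2 :+ (v :+ (u :+ w))) refl (length U) (length V) (length W)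

  count-insertAround : ∀ v x V U W →
    count v (insertAround x V (U , W)) ≡ 2 * δ v x + (count v V + count v (U ++ W))
  count-insertAround v x V U W
    rewrite count-++ v U (x ∷ V ++ x ∷ W) | count-++ v V (x ∷ W) | count-++ v U W =
    solve 4 (λ d u v w → u :+ (d :+ (v :+ (d :+ w))) := con 2 :* d :+ (v :+ (u :+ w))) refl
      (δ v x) (count v U) (count v V) (count v W)

  qs-length : ∀ f xs {w} → w ∈ qs f xs → length w ≡ 2 * length xs
  qs-length zero    []       (here refl) = refl
  qs-length (suc f) []       (here refl) = refl
  qs-length (suc f) (x ∷ xs) w∈ = go (∈-qs⁻ f x xs w∈)
    where
    open ≡-Reasoning
    go : ∀ {w} → Decomposition f x xs w → length w ≡ 2 * length (x ∷ xs)
    go (decomposition {A} {B} {V} {U} {W} int V∈ UW∈ refl) = begin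
      length (insertAround x V (U , W))   ≡⟨ length-insertAround x V U W ⟩
      2 + (length V + length (U ++ W))    ≡⟨ cong₂ (λ p q → 2 + (p + q)) (qs-length f A V∈) (qs-length f B UW∈) ⟩
      2 + (2 * length A + 2 * length B)   ≡⟨ cong (2 +_) (*-distribˡ-+ 2 (length A) (length B)) ⟨
      2 + 2 * (length A + length B)       ≡⟨ cong (λ l → 2 + 2 * l) (interleaving-length int) ⟩
      2 + 2 * length xs                   ≡⟨ *-suc 2 (length xs) ⟨
      2 * suc (length xs)                 ∎

  qs-count : ∀ f xs {w} → w ∈ qs f xs → ∀ v → count v w ≡ 2 * count v xs
  qs-count zero    []       (here refl) v = refl
  qs-count (suc f) []       (here refl) v = refl
  qs-count (suc f) (x ∷ xs) w∈ v = go (∈-qs⁻ f x xs w∈)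
    where
    open ≡-Reasoning
    go : ∀ {w} → Decomposition f x xs w → count v w ≡ 2 * count v (x ∷ xs)
    go (decomposition {A} {B} {V} {U} {W} int V∈ UW∈ refl) = begin
      count v (insertAround x V (U , W))              ≡⟨ count-insertAround v x V U W ⟩
      2 * δ v x + (count v V + count v (U ++ W))      ≡⟨ cong₂ (λ p q → 2 * δ v x + (p + q)) (qs-count f A V∈ v) (qs-count f B UW∈ v) ⟩
      2 * δ v x + (2 * count v A + 2 * count v B)     ≡⟨ cong (2 * δ v x +_) (*-distribˡ-+ 2 (count v A) (count v B)) ⟨
      2 * δ v x + 2 * (count v A + count v B)         ≡⟨ cong (λ l → 2 * δ v x + 2 * l) (interleaving-count v int) ⟩
      2 * δ v x + 2 * count v xs                      ≡⟨ *-distribˡ-+ 2 (δ v x) (count v xs) ⟨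
      2 * (δ v x + count v xs)                        ∎

  qs-∉ : ∀ {v} f xs {w} → w ∈ qs f xs → v ∉ xs → v ∉ w
  qs-∉ {v} f xs w∈ v∉ = count≡0⇒∉ (trans (qs-count f xs w∈ v) (cong (2 *_) (count-∉ xs v∉)))

  qs-∈ : ∀ {v} f xs {w} → w ∈ qs f xs → v ∈ w → v ∈ xs
  qs-∈ {v} f xs w∈ v∈ = count≢0⇒∈ v xs λ eq → count-∈ v∈ (trans (qs-count f xs w∈ v) (cong (2 *_) eq))

  -- Noncrossing words and insertion

  module _ where
    private variable
      s P M R : List ℕ

    ⊆-drop-prefix : All (_∉ P) s → s ⊆ P ++ R → s ⊆ R
    ⊆-drop-prefix {P = []}    _          τ          = τ
    ⊆-drop-prefix {P = p ∷ P} ∉s         (p ∷ʳ τ)   = ⊆-drop-prefix (All.map (_∘ there) ∉s) τ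
    ⊆-drop-prefix {P = p ∷ P} (s∉ ∷ _)   (refl ∷ τ) = contradiction (here refl) s∉

    ⊆-drop-suffix : ∀ M → All (_∉ R) s → s ⊆ M ++ R → s ⊆ M
    ⊆-drop-suffix []      []        τ          = minimum _
    ⊆-drop-suffix []      (s∉ ∷ _)  τ          = contradiction (to∈ τ) s∉
    ⊆-drop-suffix (m ∷ M) ∉s        (m ∷ʳ τ)   = m ∷ʳ ⊆-drop-suffix M ∉s τ
    ⊆-drop-suffix (m ∷ M) (_ ∷ ∉s)  (refl ∷ τ) = refl ∷ ⊆-drop-suffix M ∉s τ

    ⊆-drop-middle : ∀ P → All (_∉ M) s → s ⊆ P ++ M ++ R → s ⊆ P ++ R
    ⊆-drop-middle []      ∉s       τ          = ⊆-drop-prefix ∉s τ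
    ⊆-drop-middle (p ∷ P) ∉s       (p ∷ʳ τ)   = p ∷ʳ ⊆-drop-middle P ∉s τ
    ⊆-drop-middle (p ∷ P) (_ ∷ ∉s) (refl ∷ τ) = refl ∷ ⊆-drop-middle P ∉s τ

    -- All copies of `a` lie in the contiguous block `M`, and hence so does everything between two
    -- of them.
    between-∈ : ∀ {a b} → a ∉ P → a ∉ R → a ∷ b ∷ a ∷ [] ⊆ P ++ M ++ R → b ∈ M
    between-∈ {P = p ∷ P}           a∉P a∉R (p ∷ʳ τ)   = between-∈ (a∉P ∘ there) a∉R τ
    between-∈ {P = p ∷ P}           a∉P a∉R (refl ∷ τ) = contradiction (here refl) a∉P
    between-∈ {P = []} {M = []}     a∉P a∉R τ          = contradiction (to∈ τ) a∉R
    between-∈ {P = []} {M = m ∷ M}  a∉P a∉R (m ∷ʳ τ)   = there (between-∈ {P = []} a∉P a∉R τ)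
    between-∈ {P = []} {M = m ∷ M}  a∉P a∉R (refl ∷ τ) = there (before-∈ M a∉R τ)
      where
      before-∈ : ∀ {a b R} M → a ∉ R → b ∷ a ∷ [] ⊆ M ++ R → b ∈ M
      before-∈ []      a∉R τ          = contradiction (to∈ (∷ˡ⁻ τ)) a∉R
      before-∈ (m ∷ M) a∉R (m ∷ʳ τ)   = there (before-∈ M a∉R τ)
      before-∈ (m ∷ M) a∉R (refl ∷ τ) = here refl

  -- In a crossing each letter has a copy of the other between two of its own. The block V therefore
  -- contains both letters or neither, and the block x V x does not separate x from a letter of UW
  -- either. What remains is a crossing inside V, one inside UW, or four copies of x, of which there
  -- are only two. `assoc₁` and `assoc₂` exhibit the two blocks.
  insertAround-noncrossing : ∀ {x} V U W → x ∉ V → x ∉ U ++ W → (∀ {v} → v ∈ V → v ∉ U ++ W) →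
    ¬ Crossing V → ¬ Crossing (U ++ W) → ¬ Crossing (insertAround x V (U , W))
  insertAround-noncrossing {x} V U W x∉V x∉UW disj ncV ncUW (a , b , τ) =
    cases (a ≟ x) (b ≟ x) (a ∈? V) (b ∈? V)
    where
    x∉U : x ∉ U
    x∉U = x∉UW ∘ ∈-++⁺ˡ
    x∉W : x ∉ W
    x∉W = x∉UW ∘ ∈-++⁺ʳ U
    aba : a ∷ b ∷ a ∷ [] ⊆ insertAround x V (U , W)
    aba = ⊆-trans (refl ∷ refl ∷ refl ∷ b ∷ʳ []) τ
    bab : b ∷ a ∷ b ∷ [] ⊆ insertAround x V (U , W)
    bab = ∷ˡ⁻ τ
    assoc₁ : insertAround x V (U , W) ≡ (U ++ x ∷ []) ++ V ++ x ∷ W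
    assoc₁ = sym (++-assoc U (x ∷ []) _)
    assoc₂ : insertAround x V (U , W) ≡ U ++ (x ∷ V ++ x ∷ []) ++ W
    assoc₂ = cong (λ r → U ++ x ∷ r) (sym (++-assoc V (x ∷ []) W))
    ∉Ux : ∀ {v} → v ∈ V → v ∉ U ++ x ∷ []
    ∉Ux v∈ p with ∈-++⁻ U p
    ... | inj₁ q           = disj v∈ (∈-++⁺ˡ q)
    ... | inj₂ (here refl) = x∉V v∈
    ∉xW : ∀ {v} → v ∈ V → v ∉ x ∷ W
    ∉xW v∈ (here refl) = x∉V v∈
    ∉xW v∈ (there q)   = disj v∈ (∈-++⁺ʳ U q)
    ∉xVx : ∀ {v} → v ≢ x → v ∉ V → v ∉ x ∷ V ++ x ∷ []
    ∉xVx v≢x v∉V (here refl) = v≢x refl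
    ∉xVx v≢x v∉V (there p) with ∈-++⁻ V p
    ... | inj₁ q           = v∉V q
    ... | inj₂ (here refl) = v≢x refl
    cases : Dec (a ≡ x) → Dec (b ≡ x) → Dec (a ∈ V) → Dec (b ∈ V) → ⊥
    cases _ _ (yes a∈) (yes b∈) = ncV (a , b ,
      ⊆-drop-suffix V (∉xW a∈ ∷ ∉xW b∈ ∷ ∉xW a∈ ∷ ∉xW b∈ ∷ [])
        (⊆-drop-prefix (∉Ux a∈ ∷ ∉Ux b∈ ∷ ∉Ux a∈ ∷ ∉Ux b∈ ∷ []) (subst (_ ⊆_) assoc₁ τ)))
    cases _ _ (yes a∈) (no b∉) = b∉ (between-∈ (∉Ux a∈) (∉xW a∈) (subst (_ ⊆_) assoc₁ aba))
    cases _ _ (no a∉) (yes b∈) = a∉ (between-∈ (∉Ux b∈) (∉xW b∈) (subst (_ ⊆_) assoc₁ bab))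
    cases (yes refl) (yes refl) _ _ = x∉W (afterV V x∉V (∷ˡ⁻ (∷⁻ (⊆-drop-prefix (x∉U ∷ x∉U ∷ x∉U ∷ x∉U ∷ []) τ))))
      where
      afterV : ∀ V {r} → x ∉ V → x ∷ x ∷ r ⊆ V ++ x ∷ W → x ∈ W
      afterV []      _  (_ ∷ʳ σ)   = to∈ σ
      afterV []      _  (refl ∷ σ) = to∈ σ
      afterV (v ∷ V) x∉ (_ ∷ʳ σ)   = afterV V (x∉ ∘ there) σ
      afterV (v ∷ V) x∉ (refl ∷ σ) = contradiction (here refl) x∉
    cases (yes refl) (no b≢x) _ (no b∉) = ∉xVx b≢x b∉ (between-∈ x∉U x∉W (subst (_ ⊆_) assoc₂ aba))
    cases (no a≢x) (yes refl) (no a∉) _ = ∉xVx a≢x a∉ (between-∈ x∉U x∉W (subst (_ ⊆_) assoc₂ bab))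
    cases (no a≢x) (no b≢x) (no a∉) (no b∉) = ncUW (a , b ,
      ⊆-drop-middle U (∉xVx a≢x a∉ ∷ ∉xVx b≢x b∉ ∷ ∉xVx a≢x a∉ ∷ ∉xVx b≢x b∉ ∷ []) (subst (_ ⊆_) assoc₂ τ))

  qs-noncrossing : ∀ f {xs w} → Sorted xs → w ∈ qs f xs → ¬ Crossing w
  qs-noncrossing zero    {[]} _ (here refl) (_ , _ , ())
  qs-noncrossing (suc f) {[]} _ (here refl) (_ , _ , ())
  qs-noncrossing (suc f) {x ∷ xs} so@(_ ∷ soxs) w∈ = go (∈-qs⁻ f x xs w∈)
    where
    x∉xs : x ∉ xs
    x∉xs = Unique.Unique[x∷xs]⇒x∉xs (sorted⇒unique so)
    disjoint : ∀ {A B v} → Interleaving A B xs → v ∈ A → v ∉ B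
    disjoint {A} {B} {v} int v∈A v∈B = contradiction
      (trans (sym (cong₂ _+_ (once (interleaving-⊆ˡ int) v∈A) (once (interleaving-⊆ʳ int) v∈B)))
        (trans (interleaving-count v int) (once ⊆-refl (Any-resp-⊆ (interleaving-⊆ˡ int) v∈A))))
      λ ()
      where
      once : ∀ {C} → C ⊆ xs → v ∈ C → count v C ≡ 1
      once τ = count-unique (sorted⇒unique (allPairs-resp-⊆ τ soxs))
    go : ∀ {w} → Decomposition f x xs w → ¬ Crossing w
    go (decomposition {A} {B} {V} {U} {W} int V∈ UW∈ refl) = insertAround-noncrossing V U W
      (qs-∉ f A V∈ (x∉xs ∘ Any-resp-⊆ (interleaving-⊆ˡ int)))
      (qs-∉ f B UW∈ (x∉xs ∘ Any-resp-⊆ (interleaving-⊆ʳ int)))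
      (λ v∈V v∈UW → disjoint int (qs-∈ f A V∈ v∈V) (qs-∈ f B UW∈ v∈UW))
      (qs-noncrossing f (allPairs-resp-⊆ (interleaving-⊆ˡ int) soxs) V∈)
      (qs-noncrossing f (allPairs-resp-⊆ (interleaving-⊆ʳ int) soxs) UW∈)

  qs-sound : ∀ f {xs w} → Sorted xs → w ∈ qs f xs → QuasiStirling xs w
  qs-sound f {xs} so w∈ = qs-count f xs w∈ , qs-noncrossing f so w∈

  noncrossing-⊆ : ∀ {v w} → v ⊆ w → ¬ Crossing w → ¬ Crossing v
  noncrossing-⊆ τ nc (a , b , σ) = nc (a , b , ⊆-trans σ τ)

  -- The two copies of `x` cut the word into `U`, `V` and `W`, and the alphabet of `V` is the set of
  -- letters occurring in it. A letter shared with `U ++ W` would cross `x`, so both copies of every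
  -- other letter lie on the same side.
  qs-complete : ∀ f {xs w} → length xs ≤ f → Sorted xs → QuasiStirling xs w → w ∈ qs f xs
  qs-complete f {[]} {[]} _ _ _ = ∈-qs[] f
    where
    ∈-qs[] : ∀ f → [] ∈ qs f []
    ∈-qs[] zero    = here refl
    ∈-qs[] (suc f) = here refl
  qs-complete f {[]} {y ∷ w} _ _ (tw , _) = contradiction (tw y) (count-∈ {y} {y ∷ w} (here refl))
  qs-complete (suc f) {x ∷ xs} {w} (s≤s len) so@(_ ∷ soxs) (tw , nc)
    with U , R , refl , x∉U , cR ← firstOccurrence x w
           (trans (tw x) (cong (2 *_) (count-unique (sorted⇒unique so) (here refl))))
    with V , W , refl , x∉V , x∉W ← firstOccurrence x R cR
    with A , B , int , cA , cB ← interleaveBy (λ v → 0 <ᵇ count v V) xs =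
    ∈-qs⁺ (decomposition {U = U} {W} int
      (qs-complete f (≤-trans (length-mono-≤ (interleaving-⊆ˡ int)) len) (allPairs-resp-⊆ (interleaving-⊆ˡ int) soxs)
        (twV , noncrossing-⊆ V⊆ nc))
      (qs-complete f (≤-trans (length-mono-≤ (interleaving-⊆ʳ int)) len) (allPairs-resp-⊆ (interleaving-⊆ʳ int) soxs)
        (twUW , noncrossing-⊆ UW⊆ nc))
      refl)
    where
    V⊆ : V ⊆ U ++ x ∷ V ++ x ∷ W
    V⊆ = ++⁺ˡ U (x ∷ʳ ++⁺ʳ (x ∷ W) ⊆-refl)
    UW⊆ : U ++ W ⊆ U ++ x ∷ V ++ x ∷ W
    UW⊆ = ++⁺ ⊆-refl (x ∷ʳ ++⁺ˡ V (x ∷ʳ ⊆-refl))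

    sum≡ : ∀ v → count v V + count v (U ++ W) ≡ 2 * count v xs
    sum≡ v = +-cancelˡ-≡ (2 * δ v x) _ _
      (trans (sym (count-insertAround v x V U W)) (trans (tw v) (*-distribˡ-+ 2 (δ v x) (count v xs))))

    V∩UW : ∀ v → count v V ≢ 0 → count v (U ++ W) ≡ 0
    V∩UW v c≢0 = count-∉ (U ++ W) λ v∈UW → [ inU , inW ]′ (∈-++⁻ U v∈UW)
      where
      v∈V : v ∈ V
      v∈V = count≢0⇒∈ v V c≢0
      -- A letter v in `U` and `V` produces v x v x; in `V` and `W` it produces x v x v.
      inU : v ∈ U → ⊥
      inU v∈U = nc (v , x , ++⁺ (from∈ v∈U) (refl ∷ ++⁺ (from∈ v∈V) (refl ∷ minimum W)))
      inW : v ∈ W → ⊥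
      inW v∈W = nc (x , v , ++⁺ (minimum U) (refl ∷ ++⁺ (from∈ v∈V) (refl ∷ from∈ v∈W)))

    twV : ∀ v → count v V ≡ 2 * count v A
    twV v with count v V in eq | cA v
    ... | zero  | p = sym (cong (2 *_) p)
    ... | suc c | p rewrite p = trans (sym (trans (cong₂ _+_ eq (V∩UW v (λ e → 0≢1+n (trans (sym e) eq)))) (+-identityʳ _))) (sum≡ v)

    twUW : ∀ v → count v (U ++ W) ≡ 2 * count v B
    twUW v with count v V in eq | cB v
    ... | zero  | p rewrite p = trans (cong (_+ count v (U ++ W)) (sym eq)) (sum≡ v)
    ... | suc c | p rewrite p = V∩UW v (λ e → 0≢1+n (trans (sym e) eq))

  -- Each word can be decoded: its two copies of `x` give back `U`, `V` and `W`, and the counts in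
  -- `V` give back the split of the alphabet. Each of the nested `concatMap`s requires this for its
  -- own index.
  qs-unique : ∀ f {xs} → Sorted xs → Unique (qs f xs)
  qs-unique zero    {[]}     _ = [] ∷ []
  qs-unique (suc f) {[]}     _ = [] ∷ []
  qs-unique zero    {_ ∷ _}  _ = []
  qs-unique (suc f) {x ∷ xs} so@(_ ∷ soxs) = concatMap-unique _ (splits-unique (sorted⇒unique soxs))
    (λ {(A , B)} AB∈ → let int = ∈-splits⁻ xs AB∈ in
      concatMap-unique _ (qs-unique f (sortedˡ int))
        (λ {V} V∈ → concatMap-unique _ (qs-unique f (sortedʳ int))
          (λ {z} z∈ → mapUnique V z (x∉ˡ int V∈) (x∉ʳ int z∈))
          λ z∈ z′∈ w∈ w′∈ → proj₂ (decode int int V∈ V∈ z∈ z′∈ w∈ w′∈))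
        λ V∈ V′∈ w∈ w′∈ →
          let z , z∈ , w∈₁ = concatMap-∈⁻ _ (qs f B) w∈
              z′ , z′∈ , w′∈₁ = concatMap-∈⁻ _ (qs f B) w′∈
          in proj₁ (decode int int V∈ V′∈ z∈ z′∈ w∈₁ w′∈₁))
    λ {(A , B)} {(A′ , B′)} AB∈ AB′∈ w∈ w′∈ →
      let V , V∈ , w∈₁ = concatMap-∈⁻ _ (qs f A) w∈
          z , z∈ , w∈₂ = concatMap-∈⁻ _ (qs f B) w∈₁
          V′ , V′∈ , w′∈₁ = concatMap-∈⁻ _ (qs f A′) w′∈
          z′ , z′∈ , w′∈₂ = concatMap-∈⁻ _ (qs f B′) w′∈₁
          int = ∈-splits⁻ xs AB∈
          int′ = ∈-splits⁻ xs AB′∈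
          V≡ = proj₁ (decode int int′ V∈ V′∈ z∈ z′∈ w∈₂ w′∈₂)
          A≡ , B≡ = interleaving-unique (sorted⇒unique soxs) int int′ (λ v → *-cancelˡ-≡ _ _ 2
            (trans (sym (qs-count f A V∈ v)) (trans (cong (count v) V≡) (qs-count f A′ V′∈ v))))
      in cong₂ _,_ A≡ B≡
    where
    x∉xs : x ∉ xs
    x∉xs = Unique.Unique[x∷xs]⇒x∉xs (sorted⇒unique so)
    sortedˡ : ∀ {A B} → Interleaving A B xs → Sorted A
    sortedˡ int = allPairs-resp-⊆ (interleaving-⊆ˡ int) soxs
    sortedʳ : ∀ {A B} → Interleaving A B xs → Sorted B
    sortedʳ int = allPairs-resp-⊆ (interleaving-⊆ʳ int) soxs
    x∉ˡ : ∀ {A B V} → Interleaving A B xs → V ∈ qs f A → x ∉ V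
    x∉ˡ {A} int V∈ = qs-∉ f A V∈ (x∉xs ∘ Any-resp-⊆ (interleaving-⊆ˡ int))
    x∉ʳ : ∀ {A B z} → Interleaving A B xs → z ∈ qs f B → x ∉ z
    x∉ʳ {B = B} int z∈ = qs-∉ f B z∈ (x∉xs ∘ Any-resp-⊆ (interleaving-⊆ʳ int))

    insertAround-injective : ∀ {V V′ U U′ W W′} → x ∉ V → x ∉ V′ → x ∉ U ++ W → x ∉ U′ ++ W′ →
      insertAround x V (U , W) ≡ insertAround x V′ (U′ , W′) → V ≡ V′ × U ≡ U′ × W ≡ W′
    insertAround-injective {V} {V′} {U} {U′} x∉V x∉V′ x∉z x∉z′ eq
      with refl , eq′ ← firstOccurrence-unique U U′ (x∉z ∘ ∈-++⁺ˡ) (x∉z′ ∘ ∈-++⁺ˡ) eq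
      with refl , refl ← firstOccurrence-unique V V′ x∉V x∉V′ eq′ = refl , refl , refl

    -- The two splits are allowed to differ, because their equality is itself deduced from `V ≡ V′`.
    decode : ∀ {A B A′ B′ V V′ z z′ w} → Interleaving A B xs → Interleaving A′ B′ xs →
      V ∈ qs f A → V′ ∈ qs f A′ → z ∈ qs f B → z′ ∈ qs f B′ →
      w ∈ map (insertAround x V) (cuts z) → w ∈ map (insertAround x V′) (cuts z′) → V ≡ V′ × z ≡ z′
    decode {z = z} {z′} int int′ V∈ V′∈ z∈ z′∈ w∈ w′∈
      with (U , W) , c , refl ← ∈-map⁻ _ w∈
      with (U′ , W′) , c′ , eq ← ∈-map⁻ _ w′∈
      with refl ← ∈-cuts⁻ z c | refl ← ∈-cuts⁻ z′ c′
      with refl , refl , refl ← insertAround-injective {U = U} {U′} (x∉ˡ int V∈) (x∉ˡ int′ V′∈) (x∉ʳ int z∈) (x∉ʳ int′ z′∈) eq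
      = refl , refl

    mapUnique : ∀ V z → x ∉ V → x ∉ z → Unique (map (insertAround x V) (cuts z))
    mapUnique V z x∉V x∉z = go (λ {(U , W)} p → subst (x ∉_) (sym (∈-cuts⁻ z p)) x∉z) (cuts-unique z)
      where
      go : ∀ {ps} → (∀ {p} → p ∈ ps → x ∉ proj₁ p ++ proj₂ p) → Unique ps → Unique (map (insertAround x V) ps)
      go          x∉ []       = []
      go {p ∷ ps} x∉ (p≢ ∷ uq) = All.tabulate sep ∷ go (x∉ ∘ there) uq
        where
        sep : ∀ {w} → w ∈ map (insertAround x V) ps → insertAround x V p ≢ w
        sep w∈ eq with q , q∈ , refl ← ∈-map⁻ (insertAround x V) w∈
          with _ , U≡ , W≡ ← insertAround-injective x∉V x∉V (x∉ (here refl)) (x∉ (there q∈)) eq =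
          All.lookup p≢ q∈ (cong₂ _,_ U≡ W≡)

  -- The index form of a sublist, used to pass between the four nested indices of `hasPattern` and
  -- the sublist in `Crossing`.
  data Increasing (l u : ℕ) : List ℕ → Set where
    []  : Increasing l u []
    _∷_ : ∀ {i is} → l ≤ i × i < u → Increasing (suc i) u is → Increasing l u (i ∷ is)

  increasing-suc⁻ : ∀ {l u is} → Increasing (suc l) (suc u) is → ∃ λ js → is ≡ map suc js × Increasing l u js
  increasing-suc⁻ [] = [] , refl , []
  increasing-suc⁻ ((s≤s l≤i , s≤s i<u) ∷ inc) with js , refl , inc′ ← increasing-suc⁻ inc
    = _ , refl , (l≤i , i<u) ∷ inc′

  increasing-suc⁺ : ∀ {l u is} → Increasing l u is → Increasing (suc l) (suc u) (map suc is)
  increasing-suc⁺ []                      = []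
  increasing-suc⁺ ((l≤i , i<u) ∷ inc) = (s≤s l≤i , s≤s i<u) ∷ increasing-suc⁺ inc

  increasing-weaken : ∀ {l u is} → Increasing (suc l) u is → Increasing l u is
  increasing-weaken []                  = []
  increasing-weaken ((l<i , i<u) ∷ inc) = (<⇒≤ l<i , i<u) ∷ inc

  increasing⇒⊆ : ∀ w {is} → Increasing 0 (length w) is → map (at w) is ⊆ w
  increasing⇒⊆ w [] = minimum w
  increasing⇒⊆ (x ∷ w) {zero ∷ is} (_ ∷ inc) with js , refl , inc′ ← increasing-suc⁻ inc =
    refl ∷ subst (_⊆ w) (map-∘ js) (increasing⇒⊆ w inc′)
  increasing⇒⊆ (x ∷ w) {suc i ∷ is} ((_ , s≤s i<u) ∷ inc) with js , refl , inc′ ← increasing-suc⁻ inc =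
    x ∷ʳ subst (_⊆ w) (map-∘ (i ∷ js)) (increasing⇒⊆ w ((z≤n , i<u) ∷ inc′))

  ⊆⇒increasing : ∀ {s w} → s ⊆ w → ∃ λ is → Increasing 0 (length w) is × map (at w) is ≡ s
  ⊆⇒increasing [] = [] , [] , refl
  ⊆⇒increasing {w = x ∷ w} (_ ∷ʳ τ) with is , inc , refl ← ⊆⇒increasing τ =
    map suc is , increasing-weaken (increasing-suc⁺ inc) , sym (map-∘ is)
  ⊆⇒increasing {w = x ∷ w} (refl ∷ τ) with is , inc , refl ← ⊆⇒increasing τ =
    0 ∷ map suc is , (z≤n , s≤s z≤n) ∷ increasing-suc⁺ inc , cong (x ∷_) (sym (map-∘ is))

  anyBelow⁺ : ∀ n f {i} → i < n → T (f i) → T (anyBelow n f)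
  anyBelow⁺ n f i<n fi = any⁺ f (lose (∈-upTo⁺ i<n) fi)

  anyBelow⁻ : ∀ n f → T (anyBelow n f) → ∃ λ i → i < n × T (f i)
  anyBelow⁻ n f t with i , i∈ , fi ← find (any⁻ f (upTo n) t) = i , ∈-upTo⁻ i∈ , fi

  hasPattern⇒crossing : ∀ w → T (hasPattern w) → Crossing w
  hasPattern⇒crossing w t
    with l , l<n , t₁ ← anyBelow⁻ (length w) _ t
    with k , k<l , t₂ ← anyBelow⁻ l _ t₁
    with j , j<k , t₃ ← anyBelow⁻ k _ t₂
    with i , i<j , t₄ ← anyBelow⁻ j _ t₃
    with ik , jl ← Equivalence.to (T-∧ {at w i ≡ᵇ at w k}) t₄ =
    at w i , at w j ,
    subst₂ (λ p q → at w i ∷ at w j ∷ p ∷ q ∷ [] ⊆ w) (sym (≡ᵇ⇒≡ (at w i) (at w k) ik)) (sym (≡ᵇ⇒≡ (at w j) (at w l) jl))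
      (increasing⇒⊆ w ((z≤n , <-trans i<j (<-trans j<k (<-trans k<l l<n)))
        ∷ (i<j , <-trans j<k (<-trans k<l l<n)) ∷ (j<k , <-trans k<l l<n) ∷ (k<l , l<n) ∷ []))

  crossing⇒hasPattern : ∀ w → Crossing w → T (hasPattern w)
  crossing⇒hasPattern w (a , b , τ)
    with i ∷ j ∷ k ∷ l ∷ [] , _ ∷ (i<j , _) ∷ (j<k , _) ∷ (k<l , l<n) ∷ [] , eq ← ⊆⇒increasing τ
    with ia , eq₁ ← ∷-injective eq
    with jb , eq₂ ← ∷-injective eq₁
    with ka , eq₃ ← ∷-injective eq₂
    with lb , _ ← ∷-injective eq₃ =
    anyBelow⁺ (length w) _ l<n (anyBelow⁺ l _ k<l (anyBelow⁺ k _ j<k (anyBelow⁺ j _ i<j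
      (Equivalence.from T-∧ (≡⇒≡ᵇ _ _ (trans ia (sym ka)) , ≡⇒≡ᵇ _ _ (trans jb (sym lb)))))))

  -- Agreement with the filtered list of all words

  range : ℕ → List ℕ
  range n = map suc (upTo n)

  range-sorted : ∀ n → Sorted (range n)
  range-sorted n = AllPairs.map⁺ (AllPairs.applyUpTo⁺₁ (λ i → i) n (λ i<j _ → s≤s i<j))

  length-range : ∀ n → length (range n) ≡ n
  length-range n = trans (length-map suc (upTo n)) (length-upTo n)

  ∈-words⁺ : ∀ n w → All (_∈ range n) w → w ∈ words n (length w)
  ∈-words⁺ n []      []        = here refl
  ∈-words⁺ n (x ∷ w) (x∈ ∷ w∈) = concatMap-∈⁺ _ x∈ (∈-map⁺ _ (∈-words⁺ n w w∈))

  ∈-words⁻ : ∀ n L {w} → w ∈ words n L → All (_∈ range n) w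
  ∈-words⁻ n zero    (here refl) = []
  ∈-words⁻ n (suc L) w∈
    with v , v∈ , w∈₁ ← concatMap-∈⁻ _ (range n) w∈
    with w′ , w′∈ , refl ← ∈-map⁻ _ w∈₁ = v∈ ∷ ∈-words⁻ n L w′∈

  words-unique : ∀ n L → Unique (words n L)
  words-unique n zero    = [] ∷ []
  words-unique n (suc L) = concatMap-unique _ (sorted⇒unique (range-sorted n))
    (λ _ → Unique.map⁺ ∷-injectiveʳ (words-unique n L))
    λ _ _ w∈ w′∈ → same (∈-map⁻ _ w∈) (∈-map⁻ _ w′∈)
    where
    same : ∀ {v v′ w} → (∃ λ u → u ∈ words n L × w ≡ v ∷ u) → (∃ λ u → u ∈ words n L × w ≡ v′ ∷ u) → v ≡ v′
    same (_ , _ , refl) (_ , _ , refl) = refl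

  module _ (p : ℕ → Bool) where

    T-foldr⁻ : ∀ xs → T (foldr (λ v b → p v ∧ b) true xs) → All (T ∘ p) xs
    T-foldr⁻ []       t = []
    T-foldr⁻ (x ∷ xs) t = let px , t′ = Equivalence.to T-∧ t in px ∷ T-foldr⁻ xs t′

    T-foldr⁺ : ∀ {xs} → All (T ∘ p) xs → T (foldr (λ v b → p v ∧ b) true xs)
    T-foldr⁺ []         = tt
    T-foldr⁺ (px ∷ pxs) = Equivalence.from T-∧ (px , T-foldr⁺ pxs)

  T-not⁻ : ∀ {b} → T (not b) → ¬ T b
  T-not⁻ {false} _ ()

  T-not⁺ : ∀ {b} → ¬ T b → T (not b)
  T-not⁺ {false} _ = tt
  T-not⁺ {true}  n = n tt

  quasiStirling⁻ : ∀ n {w} → w ∈ quasiStirling n → QuasiStirling (range n) w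
  quasiStirling⁻ n {w} w∈
    with w∈words , t ← ∈-filter⁻ (T? ∘ λ w → isMultisetPerm n w ∧ not (hasPattern w)) {xs = words n (2 * n)} w∈
    with perm , nopat ← Equivalence.to (T-∧ {isMultisetPerm n w}) t =
    tw , contraposition (crossing⇒hasPattern w) (T-not⁻ nopat)
    where
    twos : All (λ v → T (count v w ≡ᵇ 2)) (range n)
    twos = T-foldr⁻ (λ v → count v w ≡ᵇ 2) (range n) (proj₂ (Equivalence.to (T-∧ {length w ≡ᵇ 2 * n}) perm))
    tw : ∀ v → count v w ≡ 2 * count v (range n)
    tw v with v ∈? range n
    ... | yes v∈ = trans (≡ᵇ⇒≡ _ _ (All.lookup twos v∈)) (cong (2 *_) (sym (count-unique (sorted⇒unique (range-sorted n)) v∈)))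
    -- `isMultisetPerm` tests only the letters of `range n`; all others are excluded by membership
    -- in `words`.
    ... | no v∉  = trans (count-∉ w (v∉ ∘ All.lookup (∈-words⁻ n (2 * n) w∈words))) (cong (2 *_) (sym (count-∉ (range n) v∉)))

  quasiStirling⁺ : ∀ n {w} → length w ≡ 2 * n → QuasiStirling (range n) w → w ∈ quasiStirling n
  quasiStirling⁺ n {w} len (tw , nc) =
    ∈-filter⁺ (T? ∘ λ w → isMultisetPerm n w ∧ not (hasPattern w))
      (subst (λ L → w ∈ words n L) len (∈-words⁺ n w (All.tabulate letter)))
      (Equivalence.from T-∧ (Equivalence.from T-∧ (≡⇒≡ᵇ _ _ len , T-foldr⁺ _ (All.tabulate two))
        , T-not⁺ (contraposition (hasPattern⇒crossing w) nc)))
    where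
    letter : ∀ {v} → v ∈ w → v ∈ range n
    letter {v} v∈ = count≢0⇒∈ v (range n) λ eq → count-∈ v∈ (trans (tw v) (cong (2 *_) eq))
    two : ∀ {v} → v ∈ range n → T (count v w ≡ᵇ 2)
    two {v} v∈ = ≡⇒≡ᵇ _ _ (trans (tw v) (cong (2 *_) (count-unique (sorted⇒unique (range-sorted n)) v∈)))

  -- Both lists are duplicate-free and have the same members, so either can be used when counting
  -- words by descents.
  quasiStirling↭qs : ∀ n → quasiStirling n ↭ qs n (range n)
  quasiStirling↭qs n = ∼bag⇒↭ (unique∧set⇒bag
    (Unique.filter⁺ _ (words-unique n (2 * n)))
    (qs-unique n (range-sorted n))
    (mk⇔ (qs-complete n (≤-reflexive (length-range n)) (range-sorted n) ∘ quasiStirling⁻ n)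
      (λ w∈ → quasiStirling⁺ n (trans (qs-length n (range n) w∈) (cong (2 *_) (length-range n)))
        (qs-sound n (range-sorted n) w∈))))

  -- Descents under insertion

  <ᵇ-false : ∀ {m n} → n ≤ m → (m <ᵇ n) ≡ false
  <ᵇ-false {m} {n} n≤m with m <ᵇ n in eq
  ... | false = refl
  ... | true  = contradiction (<ᵇ⇒< m n (subst T (sym eq) _)) (≤⇒≯ n≤m)

  <ᵇ-true : ∀ {m n} → m < n → (m <ᵇ n) ≡ true
  <ᵇ-true {m} {n} m<n with m <ᵇ n | <⇒<ᵇ m<n
  ... | true | _ = refl

  des-∷-≤ : ∀ {x y} w → x ≤ y → des (x ∷ y ∷ w) ≡ des (y ∷ w)
  des-∷-≤ w x≤y rewrite <ᵇ-false x≤y = refl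

  -- The last entry of `V` is a descent in both readings: by convention when `V` stands alone, and
  -- because it exceeds `x` when `x` follows.
  des-++-< : ∀ {x V} R → All (x <_) V → des (V ++ x ∷ R) ≡ des V + des (x ∷ R)
  des-++-< R [] = refl
  des-++-< R (x<v ∷ []) rewrite <ᵇ-true x<v = refl
  des-++-< {x} {v ∷ v′ ∷ V} R (_ ∷ x<V) =
    trans (cong ((if v′ <ᵇ v then 1 else 0) +_) (des-++-< R x<V)) (sym (+-assoc (if v′ <ᵇ v then 1 else 0) _ _))

  -- The first `x` is followed by an entry that is at least `x`, so it is not a descent. The second
  -- stays inside `des (x ∷ W)`: when the entries of `W` exceed `x`, it is a descent exactly if `W`
  -- is empty.
  des-insertAround : ∀ {x V U} W → All (x <_) V → All (x <_) U →
    des (insertAround x V (U , W)) ≡ des V + (des U + des (x ∷ W))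
  des-insertAround {x} {V} {U} W x<V x<U = begin
    des (U ++ x ∷ V ++ x ∷ W)                ≡⟨ des-++-< _ x<U ⟩
    des U + des (x ∷ V ++ x ∷ W)            ≡⟨ cong (des U +_) (drop-x x<V) ⟩
    des U + des (V ++ x ∷ W)                ≡⟨ cong (des U +_) (des-++-< W x<V) ⟩
    des U + (des V + des (x ∷ W))          ≡⟨ +-assoc (des U) (des V) _ ⟨
    des U + des V + des (x ∷ W)            ≡⟨ cong (_+ des (x ∷ W)) (+-comm (des U) (des V)) ⟩
    des V + des U + des (x ∷ W)            ≡⟨ +-assoc (des V) (des U) _ ⟩
    des V + (des U + des (x ∷ W))          ∎
    where
    open ≡-Reasoning
    drop-x : ∀ {V} → All (x <_) V → des (x ∷ V ++ x ∷ W) ≡ des (V ++ x ∷ W)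
    drop-x []              = des-∷-≤ W ≤-refl
    drop-x {v ∷ V} (x<v ∷ _) = des-∷-≤ (V ++ x ∷ W) (<⇒≤ x<v)

  -- Beyond the exponents that normalise the two parts, one factor 1/(1-t) is left over for
  -- `normalised-insertions`.
  exponent-split : ∀ a b {n} → a + b ≡ n → suc (2 * suc n) ≡ suc (suc (2 * a) + suc (2 * b))
  exponent-split a b refl = solve 2 (λ a b → con 1 :+ con 2 :* (con 1 :+ (a :+ b))
    := con 1 :+ ((con 1 :+ con 2 :* a) :+ (con 1 :+ con 2 :* b))) refl a b

open Words

-- Derivations and the Burgers equation

record Derivation {c ℓ} (R : CommutativeRing c ℓ) : Set (c ⊔ ℓ) where
  open CommutativeRing R
  field
    ⟦_⟧     : Carrier → Carrier
    ⟦⟧-cong : ∀ {x y} → x ≈ y → ⟦ x ⟧ ≈ ⟦ y ⟧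
    +-homo  : ∀ x y → ⟦ x + y ⟧ ≈ ⟦ x ⟧ + ⟦ y ⟧
    leibniz : ∀ x y → ⟦ x * y ⟧ ≈ ⟦ x ⟧ * y + x * ⟦ y ⟧

module RingProperties {c ℓ} (R : CommutativeRing c ℓ) where
  open CommutativeRing R public hiding (zero)
  open Algebra.Properties.Semiring.Mult semiring public
    using (×-congʳ; ×-congˡ; ×-assocˡ; ×-comm-*; ×-assoc-*; ×-homo-1) renaming (_×_ to _⨯_)
  open Algebra.Properties.CommutativeMonoid.Mult +-commutativeMonoid public using (×-distrib-+)
  open Algebra.Properties.Semiring.Exp semiring public using (_^_; ^-congˡ; ^-congʳ; ^-homo-*)
  open Algebra.Properties.Group +-group public using (∙-cancelʳ; identityˡ-unique)
  open Relation.Binary.Reasoning.Setoid setoid public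
  open Algebra.Solver.Ring.NaturalCoefficients.Default commutativeSemiring public
    using (solve; _:+_; _:*_; _:=_; con)

  ⨯-swap : ∀ m n x → m ⨯ (n ⨯ x) ≈ n ⨯ (m ⨯ x)
  ⨯-swap m n x = begin
    m ⨯ (n ⨯ x)   ≈⟨ ×-assocˡ x m n ⟩
    (m ℕ* n) ⨯ x  ≡⟨ ≡.cong (_⨯ x) (ℕ.*-comm m n) ⟩
    (n ℕ* m) ⨯ x  ≈⟨ ×-assocˡ x n m ⟨
    n ⨯ (m ⨯ x)   ∎

  sumOver : ∀ {a} {A : Set a} → (A → Carrier) → List A → Carrier
  sumOver f []       = 0#
  sumOver f (x ∷ xs) = f x + sumOver f xs

  module _ {a} {A : Set a} where

    sumOver-cong : ∀ {f g : A → Carrier} xs → (∀ {x} → x ∈ xs → f x ≈ g x) → sumOver f xs ≈ sumOver g xs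
    sumOver-cong []       eq = refl
    sumOver-cong (x ∷ xs) eq = +-cong (eq (here ≡.refl)) (sumOver-cong xs (eq ∘ there))

    sumOver-++ : ∀ (f : A → Carrier) xs ys → sumOver f (xs ++ ys) ≈ sumOver f xs + sumOver f ys
    sumOver-++ f []       ys = sym (+-identityˡ _)
    sumOver-++ f (x ∷ xs) ys = trans (+-congˡ (sumOver-++ f xs ys)) (sym (+-assoc _ _ _))

    sumOver-+ : ∀ (f g : A → Carrier) xs → sumOver (λ x → f x + g x) xs ≈ sumOver f xs + sumOver g xs
    sumOver-+ f g []       = sym (+-identityˡ 0#)
    sumOver-+ f g (x ∷ xs) = trans (+-congˡ (sumOver-+ f g xs))
      (solve 4 (λ p q r s → (p :+ q) :+ (r :+ s) := (p :+ r) :+ (q :+ s)) refl (f x) (g x) _ _)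

    sumOver-*ʳ : ∀ (f : A → Carrier) c xs → sumOver f xs * c ≈ sumOver (λ x → f x * c) xs
    sumOver-*ʳ f c []       = zeroˡ c
    sumOver-*ʳ f c (x ∷ xs) = trans (distribʳ c _ _) (+-congˡ (sumOver-*ʳ f c xs))

    sumOver-*ˡ : ∀ (f : A → Carrier) c xs → c * sumOver f xs ≈ sumOver (λ x → c * f x) xs
    sumOver-*ˡ f c []       = zeroʳ c
    sumOver-*ˡ f c (x ∷ xs) = trans (distribˡ c _ _) (+-congˡ (sumOver-*ˡ f c xs))

    sumOver-⨯ : ∀ n (f : A → Carrier) xs → n ⨯ sumOver f xs ≈ sumOver (λ x → n ⨯ f x) xs
    sumOver-⨯ n f []       = ⨯-0 n
      where
      ⨯-0 : ∀ n → n ⨯ 0# ≈ 0#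
      ⨯-0 zero    = refl
      ⨯-0 (suc n) = trans (+-identityˡ _) (⨯-0 n)
    sumOver-⨯ n f (x ∷ xs) = trans (×-distrib-+ _ _ n) (+-congˡ (sumOver-⨯ n f xs))

  module _ {a b} {A : Set a} {B : Set b} where

    sumOver-map : ∀ (f : B → Carrier) (g : A → B) xs → sumOver f (map g xs) ≡ sumOver (f ∘ g) xs
    sumOver-map f g []       = ≡.refl
    sumOver-map f g (x ∷ xs) = ≡.cong (f (g x) +_) (sumOver-map f g xs)

    sumOver-concatMap : ∀ (f : B → Carrier) (g : A → List B) xs →
      sumOver f (concatMap g xs) ≈ sumOver (λ x → sumOver f (g x)) xs
    sumOver-concatMap f g []       = refl
    sumOver-concatMap f g (x ∷ xs) = trans (sumOver-++ f (g x) (concatMap g xs)) (+-congˡ (sumOver-concatMap f g xs))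

module DerivationProperties {c ℓ} {R : CommutativeRing c ℓ} (D : Derivation R) where
  open RingProperties R
  open Derivation D

  0-homo : ⟦ 0# ⟧ ≈ 0#
  0-homo = identityˡ-unique ⟦ 0# ⟧ ⟦ 0# ⟧ (trans (sym (+-homo 0# 0#)) (⟦⟧-cong (+-identityˡ 0#)))

  1-const : ⟦ 1# ⟧ ≈ 0#
  1-const = identityˡ-unique ⟦ 1# ⟧ ⟦ 1# ⟧ (begin
    ⟦ 1# ⟧ + ⟦ 1# ⟧           ≈⟨ +-cong (*-identityʳ _) (*-identityˡ _) ⟨
    ⟦ 1# ⟧ * 1# + 1# * ⟦ 1# ⟧ ≈⟨ leibniz 1# 1# ⟨
    ⟦ 1# * 1# ⟧               ≈⟨ ⟦⟧-cong (*-identityˡ 1#) ⟩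
    ⟦ 1# ⟧                    ∎)

  ⨯-homo : ∀ n x → ⟦ n ⨯ x ⟧ ≈ n ⨯ ⟦ x ⟧
  ⨯-homo zero    x = 0-homo
  ⨯-homo (suc n) x = trans (+-homo x (n ⨯ x)) (+-congˡ (⨯-homo n x))

  power-rule : ∀ x k → ⟦ x ^ suc k ⟧ ≈ suc k ⨯ (x ^ k * ⟦ x ⟧)
  power-rule x zero = begin
    ⟦ x * 1# ⟧        ≈⟨ ⟦⟧-cong (*-identityʳ x) ⟩
    ⟦ x ⟧             ≈⟨ *-identityˡ _ ⟨
    1# * ⟦ x ⟧        ≈⟨ +-identityʳ _ ⟨
    1# * ⟦ x ⟧ + 0#   ∎
  power-rule x (suc k) = begin
    ⟦ x * x ^ suc k ⟧                                     ≈⟨ leibniz x (x ^ suc k) ⟩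
    ⟦ x ⟧ * x ^ suc k + x * ⟦ x ^ suc k ⟧                 ≈⟨ +-cong (*-comm _ _) (*-congˡ (power-rule x k)) ⟩
    x ^ suc k * ⟦ x ⟧ + x * (suc k ⨯ (x ^ k * ⟦ x ⟧))     ≈⟨ +-congˡ (×-comm-* (suc k) x _) ⟩
    x ^ suc k * ⟦ x ⟧ + suc k ⨯ (x * (x ^ k * ⟦ x ⟧))     ≈⟨ +-congˡ (×-congʳ (suc k) (*-assoc x _ _)) ⟨
    suc (suc k) ⨯ (x ^ suc k * ⟦ x ⟧)                     ∎

  sumOver-homo : ∀ {a} {A : Set a} (f : A → Carrier) xs → ⟦ sumOver f xs ⟧ ≈ sumOver (λ x → ⟦ f x ⟧) xs
  sumOver-homo f []       = 0-homo
  sumOver-homo f (x ∷ xs) = trans (+-homo _ _) (+-congˡ (sumOver-homo f xs))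

module _ {c ℓ} {R : CommutativeRing c ℓ} (∂ θ : Derivation R) where
  open RingProperties R
  private
    module ∂ = Derivation ∂
    module θ = Derivation θ
    module ∂ₚ = DerivationProperties ∂
    module θₚ = DerivationProperties θ

  -- By the power rule both sides are (k+1)(k+2) u^(k+1) θu, once the equation has traded ∂u for θu
  -- and one more factor u.
  burgers-power : ∀ u → ∂.⟦ u ⟧ ≈ u * θ.⟦ u ⟧ → ∀ k →
    suc (suc k) ⨯ ∂.⟦ u ^ suc k ⟧ ≈ suc k ⨯ θ.⟦ u ^ suc (suc k) ⟧
  burgers-power u eq k = begin
    suc (suc k) ⨯ ∂.⟦ u ^ suc k ⟧                          ≈⟨ ×-congʳ (suc (suc k)) (∂ₚ.power-rule u k) ⟩
    suc (suc k) ⨯ (suc k ⨯ (u ^ k * ∂.⟦ u ⟧))              ≈⟨ ⨯-swap (suc (suc k)) (suc k) _ ⟩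
    suc k ⨯ (suc (suc k) ⨯ (u ^ k * ∂.⟦ u ⟧))              ≈⟨ ×-congʳ (suc k) (×-congʳ (suc (suc k)) rearrange) ⟩
    suc k ⨯ (suc (suc k) ⨯ (u ^ suc k * θ.⟦ u ⟧))          ≈⟨ ×-congʳ (suc k) (θₚ.power-rule u (suc k)) ⟨
    suc k ⨯ θ.⟦ u ^ suc (suc k) ⟧                          ∎
    where
    rearrange : u ^ k * ∂.⟦ u ⟧ ≈ u ^ suc k * θ.⟦ u ⟧
    rearrange = trans (*-congˡ eq) (solve 3 (λ a b c → a :* (b :* c) := (b :* a) :* c) refl (u ^ k) u θ.⟦ u ⟧)

-- Rings of sequences

module Sequences {c ℓ} (R : CommutativeRing c ℓ) where
  open RingProperties R

  record _≋_ (a b : ℕ → Carrier) : Set ℓ where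
    constructor pointwise
    field coeff : ∀ n → a n ≈ b n
  open _≋_ public

  -- Instantiated for two products over pointwise addition: the Hurwitz product in x and the Cauchy
  -- product in t.
  module SequenceRing (_∙_ : (ℕ → Carrier) → (ℕ → Carrier) → ℕ → Carrier) (one : ℕ → Carrier)
    (∙-cong : ∀ {a a′ b b′} → (∀ n → a n ≈ a′ n) → (∀ n → b n ≈ b′ n) → ∀ n → (a ∙ b) n ≈ (a′ ∙ b′) n)
    (∙-comm : ∀ a b n → (a ∙ b) n ≈ (b ∙ a) n)
    (∙-assoc : ∀ a b c n → ((a ∙ b) ∙ c) n ≈ (a ∙ (b ∙ c)) n)
    (∙-identityˡ : ∀ a n → (one ∙ a) n ≈ a n)
    (∙-distribʳ : ∀ c a b n → ((λ i → a i + b i) ∙ c) n ≈ (a ∙ c) n + (b ∙ c) n) where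

    sequenceRing : CommutativeRing c ℓ
    sequenceRing = record
      { Carrier = ℕ → Carrier
      ; _≈_ = _≋_
      ; _+_ = λ a b n → a n + b n
      ; _*_ = _∙_
      ; -_ = λ a n → - a n
      ; 0# = λ _ → 0#
      ; 1# = one
      ; isCommutativeRing = record
        { isRing = record
          { +-isAbelianGroup = record
            { isGroup = record
              { isMonoid = record
                { isSemigroup = record
                  { isMagma = record
                    { isEquivalence = record
                      { refl = pointwise λ _ → refl
                      ; sym = λ p → pointwise λ n → sym (coeff p n)
                      ; trans = λ p q → pointwise λ n → trans (coeff p n) (coeff q n)
                      }
                    ; ∙-cong = λ p q → pointwise λ n → +-cong (coeff p n) (coeff q n)
                    }
                  ; assoc = λ a b c → pointwise λ n → +-assoc _ _ _
                  }
                ; identity = (λ a → pointwise λ n → +-identityˡ _) , (λ a → pointwise λ n → +-identityʳ _)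
                }
              ; inverse = (λ a → pointwise λ n → -‿inverseˡ _) , (λ a → pointwise λ n → -‿inverseʳ _)
              ; ⁻¹-cong = λ p → pointwise λ n → -‿cong (coeff p n)
              }
            ; comm = λ a b → pointwise λ n → +-comm _ _
            }
          ; *-cong = λ p q → pointwise (∙-cong (coeff p) (coeff q))
          ; *-assoc = λ a b c → pointwise (∙-assoc a b c)
          ; *-identity = (λ a → pointwise (∙-identityˡ a))
                       , (λ a → pointwise λ n → trans (∙-comm a one n) (∙-identityˡ a n))
          ; distrib = (λ c a b → pointwise λ n → trans (∙-comm c _ n) (trans (∙-distribʳ c a b n) (+-cong (∙-comm a c n) (∙-comm b c n))))
                    , (λ a b c → pointwise (∙-distribʳ a b c))
          }
        ; *-comm = λ a b → pointwise (∙-comm a b)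
        }
      }

    private module S = RingProperties sequenceRing

    ⨯-coeff : ∀ k a n → (k S.⨯ a) n ≈ k ⨯ a n
    ⨯-coeff zero    a n = refl
    ⨯-coeff (suc k) a n = +-congˡ (⨯-coeff k a n)

-- Hurwitz series: the ring of exponential generating functions Σ aₙ xⁿ/n!,
-- multiplied through the Leibniz rule for d/dx, which is the shift of coefficients.
module Hurwitz {c ℓ} (R : CommutativeRing c ℓ) where
  open RingProperties R
  open Sequences R public

  -- Unfolding yields the binomial convolution Σᵢ C(n, i) aᵢ bₙ₋ᵢ.
  _⋆_ : (ℕ → Carrier) → (ℕ → Carrier) → ℕ → Carrier
  (a ⋆ b) zero    = a zero * b zero
  (a ⋆ b) (suc n) = ((a ∘ suc) ⋆ b) n + (a ⋆ (b ∘ suc)) n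

  one : ℕ → Carrier
  one zero    = 1#
  one (suc _) = 0#

  ⋆-cong : ∀ {a a′ b b′} → (∀ n → a n ≈ a′ n) → (∀ n → b n ≈ b′ n) → ∀ n → (a ⋆ b) n ≈ (a′ ⋆ b′) n
  ⋆-cong p q zero    = *-cong (p 0) (q 0)
  ⋆-cong p q (suc n) = +-cong (⋆-cong (p ∘ suc) q n) (⋆-cong p (q ∘ suc) n)

  ⋆-comm : ∀ a b n → (a ⋆ b) n ≈ (b ⋆ a) n
  ⋆-comm a b zero    = *-comm _ _
  ⋆-comm a b (suc n) = trans (+-cong (⋆-comm _ _ n) (⋆-comm _ _ n)) (+-comm _ _)

  ⋆-distribʳ : ∀ c a b n → ((λ i → a i + b i) ⋆ c) n ≈ (a ⋆ c) n + (b ⋆ c) n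
  ⋆-distribʳ c a b zero    = distribʳ _ _ _
  ⋆-distribʳ c a b (suc n) = trans (+-cong (⋆-distribʳ c (a ∘ suc) (b ∘ suc) n) (⋆-distribʳ (c ∘ suc) a b n))
    (solve 4 (λ p q r s → (p :+ q) :+ (r :+ s) := (p :+ r) :+ (q :+ s)) refl _ _ _ _)

  ⋆-distribˡ : ∀ c a b n → (c ⋆ (λ i → a i + b i)) n ≈ (c ⋆ a) n + (c ⋆ b) n
  ⋆-distribˡ c a b n = trans (⋆-comm c _ n) (trans (⋆-distribʳ c a b n) (+-cong (⋆-comm a c n) (⋆-comm b c n)))

  ⋆-assoc : ∀ a b c n → ((a ⋆ b) ⋆ c) n ≈ (a ⋆ (b ⋆ c)) n
  ⋆-assoc a b c zero    = *-assoc _ _ _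
  ⋆-assoc a b c (suc n) = begin
    ((λ i → ((a ∘ suc) ⋆ b) i + (a ⋆ (b ∘ suc)) i) ⋆ c) n + ((a ⋆ b) ⋆ (c ∘ suc)) n
      ≈⟨ +-congʳ (⋆-distribʳ c _ _ n) ⟩
    ((((a ∘ suc) ⋆ b) ⋆ c) n + ((a ⋆ (b ∘ suc)) ⋆ c) n) + ((a ⋆ b) ⋆ (c ∘ suc)) n
      ≈⟨ +-cong (+-cong (⋆-assoc _ b c n) (⋆-assoc a _ c n)) (⋆-assoc a b _ n) ⟩
    (((a ∘ suc) ⋆ (b ⋆ c)) n + (a ⋆ ((b ∘ suc) ⋆ c)) n) + (a ⋆ (b ⋆ (c ∘ suc))) n
      ≈⟨ +-assoc _ _ _ ⟩
    ((a ∘ suc) ⋆ (b ⋆ c)) n + ((a ⋆ ((b ∘ suc) ⋆ c)) n + (a ⋆ (b ⋆ (c ∘ suc))) n)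
      ≈⟨ +-congˡ (⋆-distribˡ a _ _ n) ⟨
    ((a ∘ suc) ⋆ (b ⋆ c)) n + (a ⋆ (λ i → ((b ∘ suc) ⋆ c) i + (b ⋆ (c ∘ suc)) i)) n
      ∎

  ⋆-zeroˡ : ∀ b n → ((λ _ → 0#) ⋆ b) n ≈ 0#
  ⋆-zeroˡ b zero    = zeroˡ _
  ⋆-zeroˡ b (suc n) = trans (+-cong (⋆-zeroˡ b n) (⋆-zeroˡ (b ∘ suc) n)) (+-identityˡ 0#)

  ⋆-identityˡ : ∀ b n → (one ⋆ b) n ≈ b n
  ⋆-identityˡ b zero    = *-identityˡ _
  ⋆-identityˡ b (suc n) = trans (+-cong (⋆-zeroˡ b n) (⋆-identityˡ (b ∘ suc) n)) (+-identityˡ _)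

  open SequenceRing _⋆_ one ⋆-cong ⋆-comm ⋆-assoc ⋆-identityˡ ⋆-distribʳ public
    renaming (sequenceRing to hurwitzRing)

  shift : Derivation hurwitzRing
  shift = record
    { ⟦_⟧     = _∘ suc
    ; ⟦⟧-cong = λ p → pointwise (coeff p ∘ suc)
    ; +-homo  = λ a b → pointwise λ n → refl
    ; leibniz = λ a b → pointwise λ n → refl
    }

  module _ (θ : Derivation R) where
    private module θ = Derivation θ

    ⋆-leibniz : ∀ a b n → θ.⟦ (a ⋆ b) n ⟧ ≈ ((λ i → θ.⟦ a i ⟧) ⋆ b) n + (a ⋆ (λ i → θ.⟦ b i ⟧)) n
    ⋆-leibniz a b zero    = θ.leibniz _ _
    ⋆-leibniz a b (suc n) = trans (θ.+-homo _ _) (trans (+-cong (⋆-leibniz _ b n) (⋆-leibniz a _ n))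
      (solve 4 (λ p q r s → (p :+ q) :+ (r :+ s) := (p :+ r) :+ (q :+ s)) refl _ _ _ _))

    coefficientwise : Derivation hurwitzRing
    coefficientwise = record
      { ⟦_⟧     = λ a n → θ.⟦ a n ⟧
      ; ⟦⟧-cong = λ p → pointwise λ n → θ.⟦⟧-cong (coeff p n)
      ; +-homo  = λ a b → pointwise λ n → θ.+-homo _ _
      ; leibniz = λ a b → pointwise (⋆-leibniz a b)
      }

-- Coefficients of the solution of the Burgers equation

module BurgersSolution {c ℓ} {R : CommutativeRing c ℓ} (θ : Derivation R) where
  open RingProperties R
  open Hurwitz R
  private
    module H = RingProperties hurwitzRing
    module θ = Derivation θ
    module θₚ = DerivationProperties θ

  θ^ : ℕ → Carrier → Carrier
  θ^ zero    x = x
  θ^ (suc n) x = θ.⟦ θ^ n x ⟧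

  H^-coeff₀ : ∀ a k → (a H.^ k) 0 ≈ a 0 ^ k
  H^-coeff₀ a zero    = refl
  H^-coeff₀ a (suc k) = *-congˡ (H^-coeff₀ a k)

  module _ (⨯-cancel : ∀ n {x y} → suc n ⨯ x ≈ suc n ⨯ y → x ≈ y) (u : ℕ → Carrier)
    (equation : ∀ n → u (suc n) ≈ (u ⋆ (λ i → θ.⟦ u i ⟧)) n) where

    power-step : ∀ k n → suc (suc k) ⨯ (u H.^ suc k) (suc n) ≈ suc k ⨯ θ.⟦ (u H.^ suc (suc k)) n ⟧
    power-step k n = begin
      suc (suc k) ⨯ (u H.^ suc k) (suc n)              ≈⟨ ⨯-coeff (suc (suc k)) ((u H.^ suc k) ∘ suc) n ⟨
      (suc (suc k) H.⨯ ((u H.^ suc k) ∘ suc)) n        ≈⟨ coeff (burgers-power shift (coefficientwise θ) u (pointwise equation) k) n ⟩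
      (suc k H.⨯ (λ i → θ.⟦ (u H.^ suc (suc k)) i ⟧)) n ≈⟨ ⨯-coeff (suc k) (λ i → θ.⟦ (u H.^ suc (suc k)) i ⟧) n ⟩
      suc k ⨯ θ.⟦ (u H.^ suc (suc k)) n ⟧              ∎

    -- All powers are treated at once because `power-step` lowers the order in x by one and raises
    -- the power of `u` by one. The sum `j ℕ+ n` is invariant under this exchange, which is why it
    -- gives the exponent of `u 0`.
    power-coeff : ∀ n j → suc (j ℕ+ n) ⨯ (u H.^ suc j) n ≈ suc j ⨯ θ^ n (u 0 ^ suc (j ℕ+ n))
    power-coeff zero j rewrite ℕ.+-identityʳ j = ×-congʳ (suc j) (H^-coeff₀ u (suc j))
    -- `power-step` carries the factor `suc (suc j)` on its left side, so this factor is introduced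
    -- on both sides and cancelled.
    power-coeff (suc n) j rewrite ℕ.+-suc j n = ⨯-cancel (suc j) (begin
      suc (suc j) ⨯ (suc (suc (j ℕ+ n)) ⨯ (u H.^ suc j) (suc n))
        ≈⟨ ⨯-swap (suc (suc j)) (suc (suc (j ℕ+ n))) _ ⟩
      suc (suc (j ℕ+ n)) ⨯ (suc (suc j) ⨯ (u H.^ suc j) (suc n))
        ≈⟨ ×-congʳ (suc (suc (j ℕ+ n))) (power-step j n) ⟩
      suc (suc (j ℕ+ n)) ⨯ (suc j ⨯ θ.⟦ (u H.^ suc (suc j)) n ⟧)
        ≈⟨ ⨯-swap (suc (suc (j ℕ+ n))) (suc j) _ ⟩
      suc j ⨯ (suc (suc (j ℕ+ n)) ⨯ θ.⟦ (u H.^ suc (suc j)) n ⟧)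
        ≈⟨ ×-congʳ (suc j) (θₚ.⨯-homo (suc (suc (j ℕ+ n))) _) ⟨
      suc j ⨯ θ.⟦ suc (suc (j ℕ+ n)) ⨯ (u H.^ suc (suc j)) n ⟧
        ≈⟨ ×-congʳ (suc j) (θ.⟦⟧-cong (power-coeff n (suc j))) ⟩
      suc j ⨯ θ.⟦ suc (suc j) ⨯ θ^ n (u 0 ^ suc (suc (j ℕ+ n))) ⟧
        ≈⟨ ×-congʳ (suc j) (θₚ.⨯-homo (suc (suc j)) _) ⟩
      suc j ⨯ (suc (suc j) ⨯ θ^ (suc n) (u 0 ^ suc (suc (j ℕ+ n))))
        ≈⟨ ⨯-swap (suc j) (suc (suc j)) _ ⟩
      suc (suc j) ⨯ (suc j ⨯ θ^ (suc n) (u 0 ^ suc (suc (j ℕ+ n))))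
        ∎)

    burgers-solution : ∀ n → suc n ⨯ u n ≈ θ^ n (u 0 ^ suc n)
    burgers-solution n = begin
      suc n ⨯ u n            ≈⟨ ×-congʳ (suc n) (coeff (H.*-identityʳ u) n) ⟨
      suc n ⨯ (u H.^ 1) n    ≈⟨ power-coeff n 0 ⟩
      1 ⨯ θ^ n (u 0 ^ suc n) ≈⟨ ×-homo-1 _ ⟩
      θ^ n (u 0 ^ suc n)     ∎

-- The descent generating function

module DescentSeries {c ℓ} {R : CommutativeRing c ℓ} (θ : Derivation R) where
  open RingProperties R
  open Hurwitz R using (_⋆_)
  private
    module θ = Derivation θ
    module θₚ = DerivationProperties θ

  -- g plays the role of 1/(1-t).
  module Geometric (t g : Carrier) (θt≈t : θ.⟦ t ⟧ ≈ t) (g≈1+tg : g ≈ 1# + t * g) where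

    -- This solves (1-t) x = y. After adding t g x, both sides equal g x: one by the equation for g,
    -- the other by the equation for x.
    fixedPoint : ∀ x y → x ≈ y + t * x → x ≈ g * y
    fixedPoint x y eq = ∙-cancelʳ (t * g * x) _ _ (begin
      x + t * g * x            ≈⟨ solve 2 (λ p x → x :+ p :* x := (con 1 :+ p) :* x) refl (t * g) x ⟩
      (1# + t * g) * x         ≈⟨ *-congʳ g≈1+tg ⟨
      g * x                    ≈⟨ *-congˡ eq ⟩
      g * (y + t * x)          ≈⟨ solve 4 (λ g y t x → g :* (y :+ t :* x) := g :* y :+ t :* g :* x) refl g y t x ⟩
      g * y + t * g * x        ∎)

    g-inverse : ∀ {e} → e ≈ 1# - t → g * e ≈ 1#
    g-inverse {e} eq = sym (fixedPoint 1# e (begin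
      1#                 ≈⟨ +-identityʳ 1# ⟨
      1# + 0#            ≈⟨ +-congˡ (-‿inverseˡ t) ⟨
      1# + (- t + t)     ≈⟨ +-assoc 1# (- t) t ⟨
      (1# - t) + t       ≈⟨ +-cong eq (*-identityʳ t) ⟨
      e + t * 1#         ∎))

    g^-inverse : ∀ {e} → e ≈ 1# - t → ∀ k → g ^ k * e ^ k ≈ 1#
    g^-inverse     eq zero    = *-identityˡ 1#
    g^-inverse {e} eq (suc k) = trans
      (solve 4 (λ a b c d → (a :* c) :* (b :* d) := (a :* b) :* (c :* d)) refl g e (g ^ k) (e ^ k))
      (trans (*-cong (g-inverse eq) (g^-inverse eq k)) (*-identityˡ 1#))

    -- Applying θ to g = 1 + t g gives θg = t g + t θg; multiplied by g, this can be compared with g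
    -- θg = θg + t g θg.
    θg : θ.⟦ g ⟧ ≈ t * g * g
    θg = ∙-cancelʳ (t * g * θ.⟦ g ⟧) _ _ (begin
      θ.⟦ g ⟧ + t * g * θ.⟦ g ⟧               ≈⟨ solve 3 (λ a b c → c :+ a :* b :* c := (con 1 :+ a :* b) :* c) refl t g θ.⟦ g ⟧ ⟩
      (1# + t * g) * θ.⟦ g ⟧                  ≈⟨ *-congʳ g≈1+tg ⟨
      g * θ.⟦ g ⟧                             ≈⟨ *-congˡ (θ.⟦⟧-cong g≈1+tg) ⟩
      g * θ.⟦ 1# + t * g ⟧                    ≈⟨ *-congˡ (trans (θ.+-homo _ _) (+-cong θₚ.1-const (θ.leibniz t g))) ⟩
      g * (0# + (θ.⟦ t ⟧ * g + t * θ.⟦ g ⟧))  ≈⟨ *-congˡ (+-congˡ (+-congʳ (*-congʳ θt≈t))) ⟩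
      g * (0# + (t * g + t * θ.⟦ g ⟧))        ≈⟨ solve 3 (λ a b c → b :* (con 0 :+ (a :* b :+ a :* c)) := a :* b :* b :+ a :* b :* c) refl t g θ.⟦ g ⟧ ⟩
      t * g * g + t * g * θ.⟦ g ⟧             ∎)

    θg^ : ∀ k → θ.⟦ g ^ k ⟧ ≈ k ⨯ (t * g * g ^ k)
    θg^ zero    = θₚ.1-const
    θg^ (suc k) = trans (θₚ.power-rule g k) (×-congʳ (suc k)
      (trans (*-congˡ θg) (solve 3 (λ a b c → c :* (a :* b :* b) := a :* b :* (b :* c)) refl t g (g ^ k))))

    θt^ : ∀ k → θ.⟦ t ^ k ⟧ ≈ k ⨯ (t ^ k)
    θt^ zero    = θₚ.1-const
    θt^ (suc k) = trans (θₚ.power-rule t k) (×-congʳ (suc k) (trans (*-congˡ θt≈t) (*-comm _ _)))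

    -- Of the length z + 1 positions, des z keep the number of descents and the others add one.
    cuts-des-∷ : ∀ (h : ℕ → Carrier) {x} c z → All (x <_) (c ∷ z) → let d = des (c ∷ z) in
      (h d + sumOver (λ (U , W) → h (des (c ∷ U) ℕ+ des (x ∷ W))) (cuts z)) + d ⨯ h (suc d)
        ≈ d ⨯ h d + suc (suc (length z)) ⨯ h (suc d)
    cuts-des-∷ h c [] _ =
      solve 2 (λ a b → (a :+ (b :+ con 0)) :+ (b :+ con 0) := (a :+ con 0) :+ (b :+ (b :+ con 0))) refl (h 1) (h 2)
    cuts-des-∷ h {x} c (c′ ∷ z) (_ ∷ x<c′ ∷ x<z)
      rewrite sumOver-map (λ (U , W) → h (des (c ∷ U) ℕ+ des (x ∷ W))) (map₁ (c′ ∷_)) (cuts z)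
            | des-∷-≤ z (ℕ.<⇒≤ x<c′)
      with c′ <ᵇ c
    -- `c` is no descent here, and inserting `x` between `c` and `c′` makes it one: this cut
    -- contributes `h (suc d)`.
    ... | false = begin
      (h d + (h (suc d) + s)) + d ⨯ h (suc d)             ≈⟨ solve 4 (λ a b c e → (a :+ (b :+ c)) :+ e := b :+ ((a :+ c) :+ e)) refl (h d) (h (suc d)) s _ ⟩
      h (suc d) + ((h d + s) + d ⨯ h (suc d))             ≈⟨ +-congˡ (cuts-des-∷ h c′ z (x<c′ ∷ x<z)) ⟩
      h (suc d) + (d ⨯ h d + suc (suc (length z)) ⨯ h (suc d)) ≈⟨ solve 3 (λ a b c → a :+ (b :+ c) := b :+ (a :+ c)) refl (h (suc d)) _ _ ⟩
      d ⨯ h d + suc (suc (suc (length z))) ⨯ h (suc d)    ∎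
      where
      d = des (c′ ∷ z)
      s = sumOver (λ (U , W) → h (des (c′ ∷ U) ℕ+ des (x ∷ W))) (cuts z)
    -- `c` is a descent before and after inserting `x` next to it, so this cut keeps the number. The
    -- descent is also counted in every later cut, hence the induction hypothesis at `h ∘ suc`.
    ... | true = begin
      (h (suc d) + (h (suc d) + s)) + suc d ⨯ h (suc (suc d))
        ≈⟨ solve 4 (λ a b c e → (a :+ (a :+ c)) :+ (b :+ e) := (a :+ b) :+ ((a :+ c) :+ e)) refl (h (suc d)) (h (suc (suc d))) s _ ⟩
      (h (suc d) + h (suc (suc d))) + ((h (suc d) + s) + d ⨯ h (suc (suc d)))
        ≈⟨ +-congˡ (cuts-des-∷ (h ∘ suc) c′ z (x<c′ ∷ x<z)) ⟩
      (h (suc d) + h (suc (suc d))) + (d ⨯ h (suc d) + suc (suc (length z)) ⨯ h (suc (suc d)))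
        ≈⟨ solve 4 (λ a b c e → (a :+ b) :+ (c :+ e) := (a :+ c) :+ (b :+ e)) refl (h (suc d)) (h (suc (suc d))) _ _ ⟩
      suc d ⨯ h (suc d) + suc (suc (suc (length z))) ⨯ h (suc (suc d)) ∎
      where
      d = des (c′ ∷ z)
      s = sumOver (λ (U , W) → h (suc (des (c′ ∷ U) ℕ+ des (x ∷ W)))) (cuts z)

    -- The front position is the cut with empty `U`; there the smaller `x` creates no descent. For
    -- the other positions the effect depends on the letter before the cut, which `cuts-des-∷`
    -- carries along as `c`.
    cuts-des : ∀ (h : ℕ → Carrier) {x} z → All (x <_) z →
      sumOver (λ (U , W) → h (des U ℕ+ des (x ∷ W))) (cuts z) + des z ⨯ h (suc (des z))
        ≈ des z ⨯ h (des z) + suc (length z) ⨯ h (suc (des z))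
    cuts-des h []      _   = +-comm _ _
    cuts-des h {x} (c ∷ z) x<z@(x<c ∷ _)
      rewrite sumOver-map (λ (U , W) → h (des U ℕ+ des (x ∷ W))) (map₁ (c ∷_)) (cuts z) | des-∷-≤ z (ℕ.<⇒≤ x<c) =
      cuts-des-∷ h c z x<z

    -- From insertions to the recursion for normalised sums

    desSum : List (List ℕ) → Carrier
    desSum = sumOver (λ w → t ^ des w)

    insertions : ℕ → List (List ℕ) → List (List ℕ) → List (List ℕ)
    insertions x Vs zs = concatMap (λ V → concatMap (λ z → map (insertAround x V) (cuts z)) zs) Vs

    -- Since θ(t^d) = d t^d, the number of descents, which varies with z, is absorbed into θ. The
    -- result is linear in t^des(z), so it can be summed over z.
    desSum-insertAround : ∀ {x} V z → All (x <_) V → All (x <_) z →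
      desSum (map (insertAround x V) (cuts z)) + t ^ des V * (t * θ.⟦ t ^ des z ⟧)
        ≈ t ^ des V * (θ.⟦ t ^ des z ⟧ + suc (length z) ⨯ (t * t ^ des z))
    desSum-insertAround {x} V z x<V x<z = begin
      desSum (map (insertAround x V) (cuts z)) + p * (t * θ.⟦ q ⟧)
        ≈⟨ +-cong (trans (reflexive (sumOver-map _ _ (cuts z))) (sumOver-cong (cuts z) eachCut)) (*-congˡ (*-congˡ (θt^ d))) ⟩
      sumOver (λ (U , W) → h (des U ℕ+ des (x ∷ W))) (cuts z) + p * (t * (d ⨯ q))
        ≈⟨ +-congˡ (trans (*-congˡ (×-comm-* d t q)) (×-comm-* d p _)) ⟩
      sumOver (λ (U , W) → h (des U ℕ+ des (x ∷ W))) (cuts z) + d ⨯ h (suc d)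
        ≈⟨ cuts-des h z x<z ⟩
      d ⨯ h d + suc (length z) ⨯ h (suc d)
        ≈⟨ +-cong (×-comm-* d p q) (×-comm-* (suc (length z)) p _) ⟨
      p * (d ⨯ q) + p * (suc (length z) ⨯ (t * q))
        ≈⟨ distribˡ p _ _ ⟨
      p * (d ⨯ q + suc (length z) ⨯ (t * q))
        ≈⟨ *-congˡ (+-congʳ (θt^ d)) ⟨
      p * (θ.⟦ q ⟧ + suc (length z) ⨯ (t * q)) ∎
      where
      d = des z
      p = t ^ des V
      q = t ^ d
      h : ℕ → Carrier
      h e = p * t ^ e
      eachCut : ∀ {UW} → UW ∈ cuts z → t ^ des (insertAround x V UW) ≈ h (des (proj₁ UW) ℕ+ des (x ∷ proj₂ UW))
      eachCut {U , W} UW∈ with ≡.refl ← ∈-cuts⁻ z UW∈ =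
        trans (^-congʳ t (des-insertAround W x<V (All.++⁻ˡ U x<z))) (^-homo-* t (des V) _)

    -- The common length of the words in `zs` makes `suc l` a constant factor, so the identities for
    -- single pairs add up to a product of two sums.
    desSum-insertions : ∀ {x} l Vs zs → (∀ {V} → V ∈ Vs → All (x <_) V) →
      (∀ {z} → z ∈ zs → All (x <_) z) → (∀ {z} → z ∈ zs → length z ≡ l) →
      desSum (insertions x Vs zs) + desSum Vs * (t * θ.⟦ desSum zs ⟧)
        ≈ desSum Vs * (θ.⟦ desSum zs ⟧ + suc l ⨯ (t * desSum zs))
    desSum-insertions {x} l Vs zs x<V x<z len = begin
      desSum (insertions x Vs zs) + desSum Vs * (t * θ.⟦ desSum zs ⟧)
        ≈⟨ +-cong (sumOver-concatMap _ _ Vs) (sumOver-*ʳ _ _ Vs) ⟩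
      sumOver (λ V → desSum (concatMap (λ z → map (insertAround x V) (cuts z)) zs)) Vs
        + sumOver (λ V → t ^ des V * (t * θ.⟦ desSum zs ⟧)) Vs
        ≈⟨ sumOver-+ _ _ Vs ⟨
      sumOver (λ V → desSum (concatMap (λ z → map (insertAround x V) (cuts z)) zs)
        + t ^ des V * (t * θ.⟦ desSum zs ⟧)) Vs
        ≈⟨ sumOver-cong Vs (λ {V} V∈ → forV V (x<V V∈)) ⟩
      sumOver (λ V → t ^ des V * (θ.⟦ desSum zs ⟧ + suc l ⨯ (t * desSum zs))) Vs
        ≈⟨ sumOver-*ʳ _ _ Vs ⟨
      desSum Vs * (θ.⟦ desSum zs ⟧ + suc l ⨯ (t * desSum zs)) ∎
      where
      q : List ℕ → Carrier
      q z = t ^ des z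
      forV : ∀ V → All (x <_) V →
        desSum (concatMap (λ z → map (insertAround x V) (cuts z)) zs) + t ^ des V * (t * θ.⟦ desSum zs ⟧)
          ≈ t ^ des V * (θ.⟦ desSum zs ⟧ + suc l ⨯ (t * desSum zs))
      forV V x<V = begin
        desSum (concatMap (λ z → map (insertAround x V) (cuts z)) zs) + p * (t * θ.⟦ desSum zs ⟧)
          ≈⟨ +-cong (sumOver-concatMap _ _ zs)
               (trans (*-congˡ (trans (*-congˡ (θₚ.sumOver-homo q zs)) (sumOver-*ˡ _ t zs))) (sumOver-*ˡ _ p zs)) ⟩
        sumOver (λ z → desSum (map (insertAround x V) (cuts z))) zs + sumOver (λ z → p * (t * θ.⟦ q z ⟧)) zs
          ≈⟨ sumOver-+ _ _ zs ⟨
        sumOver (λ z → desSum (map (insertAround x V) (cuts z)) + p * (t * θ.⟦ q z ⟧)) zs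
          ≈⟨ sumOver-cong zs (λ {z} z∈ → trans (desSum-insertAround V z x<V (x<z z∈))
               (*-congˡ (+-congˡ (×-congˡ (≡.cong suc (len z∈)))))) ⟩
        sumOver (λ z → p * (θ.⟦ q z ⟧ + suc l ⨯ (t * q z))) zs
          ≈⟨ sumOver-*ˡ _ p zs ⟨
        p * sumOver (λ z → θ.⟦ q z ⟧ + suc l ⨯ (t * q z)) zs
          ≈⟨ *-congˡ (trans (sumOver-+ _ _ zs) (+-cong (sym (θₚ.sumOver-homo q zs))
               (sym (trans (×-congʳ (suc l) (sumOver-*ˡ q t zs)) (sumOver-⨯ (suc l) _ zs))))) ⟩
        p * (θ.⟦ desSum zs ⟧ + suc l ⨯ (t * desSum zs)) ∎
        where
        p = t ^ des V

    normalised : ℕ → List ℕ → Carrier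
    normalised f xs = desSum (qs f xs) * g ^ suc (2 ℕ* length xs)

    -- The hypothesis says j = a ((1-t) θb + (l+1) t b). One factor g removes 1-t from the first
    -- term, and the second then matches b θ(g^(l+1)), because θ(g^(l+1)) = (l+1) t g^(l+2). The two
    -- together are the Leibniz rule for b g^(l+1).
    normalised-insertions : ∀ {j a b m} l e → j + a * (t * θ.⟦ b ⟧) ≈ a * (θ.⟦ b ⟧ + suc l ⨯ (t * b)) →
      m ≡ suc (e ℕ+ suc l) → j * g ^ m ≈ (a * g ^ e) * θ.⟦ b * g ^ suc l ⟧
    normalised-insertions {j} {a} {b} l e eq ≡.refl = begin
      j * (g * g ^ (e ℕ+ suc l))                               ≈⟨ *-assoc _ _ _ ⟨
      j * g * g ^ (e ℕ+ suc l)                                 ≈⟨ *-cong cancelled (^-homo-* g e (suc l)) ⟩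
      (a * θ.⟦ b ⟧ + suc l ⨯ (t * g * (a * b))) * (G * H)      ≈⟨ distribʳ _ _ _ ⟩
      a * θ.⟦ b ⟧ * (G * H) + suc l ⨯ (t * g * (a * b)) * (G * H)
        ≈⟨ +-congˡ (×-assoc-* (suc l) _ _) ⟩
      a * θ.⟦ b ⟧ * (G * H) + suc l ⨯ (t * g * (a * b) * (G * H))
        ≈⟨ +-cong (solve 4 (λ a b c d → a :* b :* (c :* d) := (a :* c) :* (b :* d)) refl a θ.⟦ b ⟧ G H)
             (×-congʳ (suc l) (solve 6 (λ t g a b c d → t :* g :* (a :* b) :* (c :* d) := (a :* c) :* (b :* (t :* g :* d))) refl t g a b G H)) ⟩
      (a * G) * (θ.⟦ b ⟧ * H) + suc l ⨯ ((a * G) * (b * (t * g * H)))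
        ≈⟨ +-congˡ (trans (*-congˡ (×-comm-* (suc l) b _)) (×-comm-* (suc l) (a * G) _)) ⟨
      (a * G) * (θ.⟦ b ⟧ * H) + (a * G) * (b * (suc l ⨯ (t * g * H)))
        ≈⟨ +-congˡ (*-congˡ (*-congˡ (θg^ (suc l)))) ⟨
      (a * G) * (θ.⟦ b ⟧ * H) + (a * G) * (b * θ.⟦ H ⟧)
        ≈⟨ distribˡ _ _ _ ⟨
      (a * G) * (θ.⟦ b ⟧ * H + b * θ.⟦ H ⟧)
        ≈⟨ *-congˡ (θ.leibniz b H) ⟨
      (a * G) * θ.⟦ b * H ⟧ ∎
      where
      G = g ^ e
      H = g ^ suc l
      cancelled : j * g ≈ a * θ.⟦ b ⟧ + suc l ⨯ (t * g * (a * b))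
      cancelled = ∙-cancelʳ (t * g * (a * θ.⟦ b ⟧)) _ _ (begin
        j * g + t * g * (a * θ.⟦ b ⟧)
          ≈⟨ solve 5 (λ j g t a b → j :* g :+ t :* g :* (a :* b) := (j :+ a :* (t :* b)) :* g) refl j g t a θ.⟦ b ⟧ ⟩
        (j + a * (t * θ.⟦ b ⟧)) * g
          ≈⟨ *-congʳ eq ⟩
        a * (θ.⟦ b ⟧ + suc l ⨯ (t * b)) * g
          ≈⟨ solve 4 (λ a b c g → a :* (b :+ c) :* g := g :* (a :* b) :+ (g :* a) :* c) refl a θ.⟦ b ⟧ _ g ⟩
        g * (a * θ.⟦ b ⟧) + (g * a) * (suc l ⨯ (t * b))
          ≈⟨ +-cong (*-congʳ g≈1+tg) (trans (×-comm-* (suc l) _ _)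
               (×-congʳ (suc l) (solve 4 (λ g a t b → (g :* a) :* (t :* b) := t :* g :* (a :* b)) refl g a t b))) ⟩
        (1# + t * g) * (a * θ.⟦ b ⟧) + suc l ⨯ (t * g * (a * b))
          ≈⟨ solve 3 (λ p q r → (con 1 :+ p) :* q :+ r := (q :+ r) :+ p :* q) refl (t * g) (a * θ.⟦ b ⟧) _ ⟩
        (a * θ.⟦ b ⟧ + suc l ⨯ (t * g * (a * b))) + t * g * (a * θ.⟦ b ⟧) ∎)

    normalised-∷ : ∀ f {x xs} → Sorted (x ∷ xs) →
      normalised (suc f) (x ∷ xs) ≈ sumOver (λ (A , B) → normalised f A * θ.⟦ normalised f B ⟧) (splits xs)
    normalised-∷ f {x} {xs} (x<xs ∷ _) = trans (*-congʳ (sumOver-concatMap _ _ (splits xs)))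
      (trans (sumOver-*ʳ _ _ (splits xs)) (sumOver-cong (splits xs) λ {(A , B)} AB∈ → forSplit A B (∈-splits⁻ xs AB∈)))
      where
      forSplit : ∀ A B → Interleaving A B xs →
        desSum (insertions x (qs f A) (qs f B)) * g ^ suc (2 ℕ* suc (length xs)) ≈ normalised f A * θ.⟦ normalised f B ⟧
      forSplit A B int = normalised-insertions (2 ℕ* length B) (suc (2 ℕ* length A))
        (desSum-insertions (2 ℕ* length B) (qs f A) (qs f B)
          (λ V∈ → All.tabulate λ v∈ → All.lookup (All-resp-⊆ (interleaving-⊆ˡ int) x<xs) (qs-∈ f A V∈ v∈))
          (λ z∈ → All.tabulate λ v∈ → All.lookup (All-resp-⊆ (interleaving-⊆ʳ int) x<xs) (qs-∈ f B z∈ v∈))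
          (qs-length f B))
        (exponent-split (length A) (length B) (interleaving-length int))

    -- The first letter goes left or right, and these two choices are the two terms in the recursive
    -- clause of `_⋆_`.
    sumOver-splits : ∀ (a b : ℕ → Carrier) xs →
      sumOver (λ (A , B) → a (length A) * b (length B)) (splits xs) ≈ (a ⋆ b) (length xs)
    sumOver-splits a b []       = +-identityʳ _
    sumOver-splits a b (x ∷ xs) = trans (sumOver-++ _ (map (map₁ (x ∷_)) (splits xs)) _)
      (+-cong (trans (reflexive (sumOver-map _ _ (splits xs))) (sumOver-splits (a ∘ suc) b xs))
              (trans (reflexive (sumOver-map _ _ (splits xs))) (sumOver-splits a (b ∘ suc) xs)))

    u : ℕ → Carrier
    u n = normalised n (range n)

    θu : ℕ → Carrier
    θu n = θ.⟦ u n ⟧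

    -- The parts of a split have alphabets other than `range n` and fuel other than their length;
    -- this property identifies their sums with terms of `u`.
    LengthOnly : ℕ → Set ℓ
    LengthOnly n = ∀ f {xs} → Sorted xs → length xs ≤ n → length xs ≤ f → normalised f xs ≈ u (length xs)

    normalised-∷-⋆ : ∀ n → LengthOnly n → ∀ f {x xs} → Sorted (x ∷ xs) → length xs ≤ n → length xs ≤ f →
      normalised (suc f) (x ∷ xs) ≈ (u ⋆ θu) (length xs)
    normalised-∷-⋆ n ih f {x} {xs} so@(_ ∷ soxs) ≤n ≤f = trans (normalised-∷ f so)
      (trans (sumOver-cong (splits xs) λ {(A , B)} AB∈ → let int = ∈-splits⁻ xs AB∈ in
          *-cong (part (interleaving-⊆ˡ int)) (θ.⟦⟧-cong (part (interleaving-⊆ʳ int))))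
        (sumOver-splits u θu xs))
      where
      part : ∀ {A} → A ⊆ xs → normalised f A ≈ u (length A)
      part τ = ih f (allPairs-resp-⊆ τ soxs) (ℕ.≤-trans (length-mono-≤ τ) ≤n) (ℕ.≤-trans (length-mono-≤ τ) ≤f)

    u-suc : ∀ n → LengthOnly n → ∀ m → m ≤ n → u (suc m) ≈ (u ⋆ θu) m
    u-suc n ih m m≤n = trans (normalised-∷-⋆ n ih m (range-sorted (suc m)) (ℕ.≤-trans (ℕ.≤-reflexive len) m≤n) (ℕ.≤-reflexive len))
      (reflexive (≡.cong (u ⋆ θu) len))
      where
      len = ℕ.suc-injective (length-range (suc m))

    lengthOnly : ∀ n → LengthOnly n
    lengthOnly n       zero    {[]}     _  _  _ = refl
    lengthOnly n       (suc f) {[]}     _  _  _ = refl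
    lengthOnly (suc n) (suc f) {x ∷ xs} so (s≤s ≤n) (s≤s ≤f) =
      -- The given alphabet and the `range` of the same size both reduce to the same convolution,
      -- through the hypothesis for shorter alphabets.
      trans (normalised-∷-⋆ n (lengthOnly n) f so ≤n ≤f) (sym (u-suc n (lengthOnly n) (length xs) ≤n))

    u-equation : ∀ n → u (suc n) ≈ (u ⋆ θu) n
    u-equation n = u-suc n (lengthOnly n) n ℕ.≤-refl

    u-0 : u 0 ≈ g
    u-0 = solve 1 (λ g → (con 1 :+ con 0) :* (g :* con 1) := g) refl g

-- Power series over ℚ

module PowerSeries where
  open ≡ using (refl; sym; trans; cong)
  open RingProperties ℚ.+-*-commutativeRing hiding (refl; sym; trans)
  open Sequences ℚ.+-*-commutativeRing

  -- The Cauchy product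

  sumBelow-head : ∀ n f → sumBelow (suc n) f ≡ f 0 + sumBelow n (f ∘ suc)
  sumBelow-head zero    f = +-comm 0ℚ (f 0)
  sumBelow-head (suc n) f = trans (cong (_+ f (suc n)) (sumBelow-head n f)) (+-assoc (f 0) _ _)

  -- With f = f₀ + t f′ this reads f g = f₀ g + t f′ g. It replaces the finite sum by a recursion,
  -- on which the ring laws below rest.
  ⊛-sucˡ : ∀ f g k → (f ⊛ g) (suc k) ≡ f 0 * g (suc k) + ((f ∘ suc) ⊛ g) k
  ⊛-sucˡ f g k = sumBelow-head (suc k) _

  ⊛-0 : ∀ f g → (f ⊛ g) 0 ≡ f 0 * g 0
  ⊛-0 f g = +-identityˡ _

  ⊛-sucʳ : ∀ f g k → (f ⊛ g) (suc k) ≡ f (suc k) * g 0 + (f ⊛ (g ∘ suc)) k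
  ⊛-sucʳ f g zero    = trans (⊛-sucˡ f g 0) (trans (+-comm (f 0 * g 1) (((f ∘ suc) ⊛ g) 0)) (≡.cong₂ _+_ (⊛-0 (f ∘ suc) g) (sym (⊛-0 f (g ∘ suc)))))
  ⊛-sucʳ f g (suc k) = begin
    (f ⊛ g) (suc (suc k))
      ≡⟨ ⊛-sucˡ f g (suc k) ⟩
    f 0 * g (suc (suc k)) + ((f ∘ suc) ⊛ g) (suc k)
      ≡⟨ cong (f 0 * g (suc (suc k)) +_) (⊛-sucʳ (f ∘ suc) g k) ⟩
    f 0 * g (suc (suc k)) + (f (suc (suc k)) * g 0 + ((f ∘ suc) ⊛ (g ∘ suc)) k)
      ≡⟨ solve 3 (λ a b c → a :+ (b :+ c) := b :+ (a :+ c)) refl (f 0 * g (suc (suc k))) (f (suc (suc k)) * g 0) _ ⟩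
    f (suc (suc k)) * g 0 + (f 0 * g (suc (suc k)) + ((f ∘ suc) ⊛ (g ∘ suc)) k)
      ≡⟨ cong (f (suc (suc k)) * g 0 +_) (⊛-sucˡ f (g ∘ suc) k) ⟨
    f (suc (suc k)) * g 0 + (f ⊛ (g ∘ suc)) (suc k) ∎

  ⊛-cong : ∀ {f f′ g g′} → (∀ k → f k ≡ f′ k) → (∀ k → g k ≡ g′ k) → ∀ k → (f ⊛ g) k ≡ (f′ ⊛ g′) k
  ⊛-cong p q zero    = ≡.cong₂ (λ a b → 0ℚ + a * b) (p 0) (q 0)
  ⊛-cong {f} {f′} {g} {g′} p q (suc k) = trans (⊛-sucˡ f g k)
    (trans (+-cong (*-cong (p 0) (q (suc k))) (⊛-cong (p ∘ suc) q k)) (sym (⊛-sucˡ f′ g′ k)))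

  ⊛-comm : ∀ f g k → (f ⊛ g) k ≡ (g ⊛ f) k
  ⊛-comm f g zero    = cong (0ℚ +_) (*-comm (f 0) (g 0))
  ⊛-comm f g (suc k) = trans (⊛-sucˡ f g k)
    (trans (+-cong (*-comm (f 0) (g (suc k))) (⊛-comm (f ∘ suc) g k)) (sym (⊛-sucʳ g f k)))

  ⊛-distribʳ : ∀ h f g k → ((λ i → f i + g i) ⊛ h) k ≡ (f ⊛ h) k + (g ⊛ h) k
  ⊛-distribʳ h f g zero = trans (⊛-0 (λ i → f i + g i) h)
    (trans (distribʳ (h 0) (f 0) (g 0)) (sym (+-cong (⊛-0 f h) (⊛-0 g h))))
  ⊛-distribʳ h f g (suc k) = begin
    ((λ i → f i + g i) ⊛ h) (suc k)
      ≡⟨ ⊛-sucˡ (λ i → f i + g i) h k ⟩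
    (f 0 + g 0) * h (suc k) + ((λ i → f (suc i) + g (suc i)) ⊛ h) k
      ≡⟨ cong ((f 0 + g 0) * h (suc k) +_) (⊛-distribʳ h (f ∘ suc) (g ∘ suc) k) ⟩
    (f 0 + g 0) * h (suc k) + (((f ∘ suc) ⊛ h) k + ((g ∘ suc) ⊛ h) k)
      ≡⟨ solve 5 (λ a b c p q → (a :+ b) :* c :+ (p :+ q) := (a :* c :+ p) :+ (b :* c :+ q)) refl (f 0) (g 0) (h (suc k)) _ _ ⟩
    (f 0 * h (suc k) + ((f ∘ suc) ⊛ h) k) + (g 0 * h (suc k) + ((g ∘ suc) ⊛ h) k)
      ≡⟨ ≡.cong₂ _+_ (⊛-sucˡ f h k) (⊛-sucˡ g h k) ⟨
    (f ⊛ h) (suc k) + (g ⊛ h) (suc k) ∎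

  ⊛-scaleˡ : ∀ c f g k → ((λ i → c * f i) ⊛ g) k ≡ c * (f ⊛ g) k
  ⊛-scaleˡ c f g zero    = solve 3 (λ c a b → con 0 :+ c :* a :* b := c :* (con 0 :+ a :* b)) refl c (f 0) (g 0)
  ⊛-scaleˡ c f g (suc k) = begin
    ((λ i → c * f i) ⊛ g) (suc k)                                       ≡⟨ ⊛-sucˡ (λ i → c * f i) g k ⟩
    c * f 0 * g (suc k) + ((λ i → c * f (suc i)) ⊛ g) k                 ≡⟨ +-cong (*-assoc c (f 0) (g (suc k))) (⊛-scaleˡ c (f ∘ suc) g k) ⟩
    c * (f 0 * g (suc k)) + c * ((f ∘ suc) ⊛ g) k                       ≡⟨ distribˡ c _ _ ⟨
    c * (f 0 * g (suc k) + ((f ∘ suc) ⊛ g) k)                           ≡⟨ cong (c *_) (⊛-sucˡ f g k) ⟨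
    c * (f ⊛ g) (suc k)                                                 ∎

  ⊛-assoc : ∀ f g h k → ((f ⊛ g) ⊛ h) k ≡ (f ⊛ (g ⊛ h)) k
  ⊛-assoc f g h zero    = solve 3 (λ a b c → con 0 :+ (con 0 :+ a :* b) :* c := con 0 :+ a :* (con 0 :+ b :* c)) refl (f 0) (g 0) (h 0)
  ⊛-assoc f g h (suc k) = begin
    ((f ⊛ g) ⊛ h) (suc k)
      ≡⟨ ⊛-sucˡ (f ⊛ g) h k ⟩
    (f ⊛ g) 0 * h (suc k) + (((f ⊛ g) ∘ suc) ⊛ h) k
      ≡⟨ +-cong (cong (_* h (suc k)) (⊛-0 f g)) (⊛-cong {g = h} (⊛-sucˡ f g) (λ _ → refl) k) ⟩
    f 0 * g 0 * h (suc k) + ((λ i → f 0 * g (suc i) + ((f ∘ suc) ⊛ g) i) ⊛ h) k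
      ≡⟨ cong (f 0 * g 0 * h (suc k) +_) (⊛-distribʳ h (λ i → f 0 * g (suc i)) ((f ∘ suc) ⊛ g) k) ⟩
    f 0 * g 0 * h (suc k) + (((λ i → f 0 * g (suc i)) ⊛ h) k + (((f ∘ suc) ⊛ g) ⊛ h) k)
      ≡⟨ cong (f 0 * g 0 * h (suc k) +_) (+-cong (⊛-scaleˡ (f 0) (g ∘ suc) h k) (⊛-assoc (f ∘ suc) g h k)) ⟩
    f 0 * g 0 * h (suc k) + (f 0 * ((g ∘ suc) ⊛ h) k + ((f ∘ suc) ⊛ (g ⊛ h)) k)
      ≡⟨ solve 5 (λ a b c p q → a :* b :* c :+ (a :* p :+ q) := a :* (b :* c :+ p) :+ q) refl (f 0) (g 0) (h (suc k)) _ _ ⟩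
    f 0 * (g 0 * h (suc k) + ((g ∘ suc) ⊛ h) k) + ((f ∘ suc) ⊛ (g ⊛ h)) k
      ≡⟨ cong (λ x → f 0 * x + ((f ∘ suc) ⊛ (g ⊛ h)) k) (⊛-sucˡ g h k) ⟨
    f 0 * (g ⊛ h) (suc k) + ((f ∘ suc) ⊛ (g ⊛ h)) k
      ≡⟨ ⊛-sucˡ f (g ⊛ h) k ⟨
    (f ⊛ (g ⊛ h)) (suc k) ∎

  ⊛-zeroˡ : ∀ f k → ((λ _ → 0ℚ) ⊛ f) k ≡ 0ℚ
  ⊛-zeroˡ f zero    = trans (⊛-0 (λ _ → 0ℚ) f) (zeroˡ (f 0))
  ⊛-zeroˡ f (suc k) = trans (⊛-sucˡ (λ _ → 0ℚ) f k) (≡.cong₂ _+_ (zeroˡ (f (suc k))) (⊛-zeroˡ f k))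

  ⊛-identityˡ : ∀ f k → (oneS ⊛ f) k ≡ f k
  ⊛-identityˡ f zero    = trans (⊛-0 oneS f) (*-identityˡ (f 0))
  ⊛-identityˡ f (suc k) = trans (⊛-sucˡ oneS f k)
    (trans (≡.cong₂ _+_ (*-identityˡ (f (suc k))) (⊛-zeroˡ f k)) (+-identityʳ _))

  open SequenceRing _⊛_ oneS ⊛-cong ⊛-comm ⊛-assoc ⊛-identityˡ ⊛-distribʳ renaming (sequenceRing to seriesRing)

  private module S = RingProperties seriesRing

  -- Induction along f = f₀ + t f′: of the k+1 copies of the coefficient of f′ g, one accounts for
  -- θt = t and the other k fall under the induction hypothesis.
  euler-leibniz : ∀ f g k → k ⨯ (f ⊛ g) k ≡ ((λ i → i ⨯ f i) ⊛ g) k + (f ⊛ (λ i → i ⨯ g i)) k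
  euler-leibniz f g zero    = solve 2 (λ a b → con 0 := (con 0 :+ con 0 :* b) :+ (con 0 :+ a :* con 0)) refl (f 0) (g 0)
  euler-leibniz f g (suc k) = begin
    suc k ⨯ (f ⊛ g) (suc k)
      ≡⟨ cong (suc k ⨯_) (⊛-sucˡ f g k) ⟩
    suc k ⨯ (f 0 * g (suc k) + ((f ∘ suc) ⊛ g) k)
      ≡⟨ ×-distrib-+ (f 0 * g (suc k)) (((f ∘ suc) ⊛ g) k) (suc k) ⟩
    suc k ⨯ (f 0 * g (suc k)) + (((f ∘ suc) ⊛ g) k + k ⨯ ((f ∘ suc) ⊛ g) k)
      ≡⟨ +-cong (sym (×-comm-* (suc k) (f 0) (g (suc k)))) (cong (((f ∘ suc) ⊛ g) k +_) (euler-leibniz (f ∘ suc) g k)) ⟩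
    f 0 * (suc k ⨯ g (suc k)) + (((f ∘ suc) ⊛ g) k + (((λ i → i ⨯ f (suc i)) ⊛ g) k + ((f ∘ suc) ⊛ (λ i → i ⨯ g i)) k))
      ≡⟨ solve 5 (λ a b c d e → b :+ (c :+ (d :+ e)) := (con 0 :* a :+ (c :+ d)) :+ (b :+ e)) refl
           (g (suc k)) (f 0 * (suc k ⨯ g (suc k))) (((f ∘ suc) ⊛ g) k) (((λ i → i ⨯ f (suc i)) ⊛ g) k) (((f ∘ suc) ⊛ (λ i → i ⨯ g i)) k) ⟩
    (0ℚ * g (suc k) + (((f ∘ suc) ⊛ g) k + ((λ i → i ⨯ f (suc i)) ⊛ g) k))
      + (f 0 * (suc k ⨯ g (suc k)) + ((f ∘ suc) ⊛ (λ i → i ⨯ g i)) k)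
      ≡⟨ ≡.cong₂ (λ p q → (0ℚ * g (suc k) + p) + q) (⊛-distribʳ g (f ∘ suc) (λ i → i ⨯ f (suc i)) k) (⊛-sucˡ f (λ i → i ⨯ g i) k) ⟨
    (0ℚ * g (suc k) + ((λ i → suc i ⨯ f (suc i)) ⊛ g) k) + (f ⊛ (λ i → i ⨯ g i)) (suc k)
      ≡⟨ cong (_+ (f ⊛ (λ i → i ⨯ g i)) (suc k)) (⊛-sucˡ (λ i → i ⨯ f i) g k) ⟨
    ((λ i → i ⨯ f i) ⊛ g) (suc k) + (f ⊛ (λ i → i ⨯ g i)) (suc k) ∎

  euler : Derivation seriesRing
  euler = record
    { ⟦_⟧     = λ f k → k ⨯ f k
    ; ⟦⟧-cong = λ p → pointwise λ k → cong (k ⨯_) (coeff p k)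
    ; +-homo  = λ f g → pointwise λ k → ×-distrib-+ (f k) (g k) k
    ; leibniz = λ f g → pointwise (euler-leibniz f g)
    }

  -- Fractions and cancellation of positive integers

  fromℚᵘ-homo-+ : ∀ p q → fromℚᵘ p + fromℚᵘ q ≡ fromℚᵘ (p ℚᵘ.+ q)
  fromℚᵘ-homo-+ p q = ℚ.toℚᵘ-injective (ℚᵘ.≃-trans (ℚ.toℚᵘ-homo-+ (fromℚᵘ p) (fromℚᵘ q))
    (ℚᵘ.≃-trans (ℚᵘ.+-cong (ℚ.toℚᵘ-fromℚᵘ p) (ℚ.toℚᵘ-fromℚᵘ q)) (ℚᵘ.≃-sym (ℚ.toℚᵘ-fromℚᵘ (p ℚᵘ.+ q)))))

  /-homo-+ : ∀ a b d → (ℤ.+ a) / suc d + (ℤ.+ b) / suc d ≡ (ℤ.+ (a ℕ+ b)) / suc d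
  /-homo-+ a b d = trans (fromℚᵘ-homo-+ (ℚᵘ.mkℚᵘ (ℤ.+ a) d) (ℚᵘ.mkℚᵘ (ℤ.+ b) d))
    (ℚ.fromℚᵘ-cong {ℚᵘ.mkℚᵘ (ℤ.+ a) d ℚᵘ.+ ℚᵘ.mkℚᵘ (ℤ.+ b) d} {ℚᵘ.mkℚᵘ (ℤ.+ (a ℕ+ b)) d} (ℚᵘ.*≡* eq))
    where
    eq : (ℤ.+ a ℤ.* ℤ.+ suc d ℤ.+ ℤ.+ b ℤ.* ℤ.+ suc d) ℤ.* ℤ.+ suc d ≡ ℤ.+ (a ℕ+ b) ℤ.* (ℤ.+ suc d ℤ.* ℤ.+ suc d)
    eq = trans (cong (ℤ._* ℤ.+ suc d) (sym (ℤ.*-distribʳ-+ (ℤ.+ suc d) (ℤ.+ a) (ℤ.+ b))))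
           (ℤ.*-assoc (ℤ.+ (a ℕ+ b)) (ℤ.+ suc d) (ℤ.+ suc d))

  ⨯-/ : ∀ k a d → k ⨯ ((ℤ.+ a) / suc d) ≡ (ℤ.+ (k ℕ* a)) / suc d
  ⨯-/ zero    a d = sym (ℚ.fromℚᵘ-cong {ℚᵘ.mkℚᵘ (ℤ.+ 0) d} {ℚᵘ.mkℚᵘ (ℤ.+ 0) 0} (ℚᵘ.*≡* refl))
  ⨯-/ (suc k) a d = trans (cong ((ℤ.+ a) / suc d +_) (⨯-/ k a d)) (/-homo-+ a (k ℕ* a) d)

  ⨯-/-cancel : ∀ n a → suc n ⨯ ((ℤ.+ a) / suc n) ≡ (ℤ.+ a) / 1
  ⨯-/-cancel n a = trans (⨯-/ (suc n) a n)
    (ℚ.fromℚᵘ-cong {ℚᵘ.mkℚᵘ (ℤ.+ (suc n ℕ* a)) n} {ℚᵘ.mkℚᵘ (ℤ.+ a) 0} (ℚᵘ.*≡* eq))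
    where
    eq : ℤ.+ (suc n ℕ* a) ℤ.* ℤ.+ 1 ≡ ℤ.+ a ℤ.* ℤ.+ suc n
    eq = trans (ℤ.*-identityʳ _) (trans (cong ℤ.+_ (ℕ.*-comm (suc n) a)) (ℤ.pos-* a (suc n)))

  ⨯-cancel : ∀ n {x y} → suc n ⨯ x ≡ suc n ⨯ y → x ≡ y
  ⨯-cancel n {x} {y} eq = trans (sym (divide x)) (trans (cong (r *_) eq) (divide y))
    where
    r = (ℤ.+ 1) / suc n
    divide : ∀ x → r * (suc n ⨯ x) ≡ x
    divide x = trans (×-comm-* (suc n) r x) (trans (sym (×-assoc-* (suc n) r x))
      (trans (cong (_* x) (⨯-/-cancel n 1)) (*-identityˡ x)))

  ⨯-cancel-S : ∀ n {f g} → suc n S.⨯ f S.≈ suc n S.⨯ g → f S.≈ g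
  ⨯-cancel-S n {f} {g} eq = pointwise λ k → ⨯-cancel n
    (trans (sym (⨯-coeff (suc n) f k)) (trans (coeff eq k) (⨯-coeff (suc n) g k)))

  -- Powers of 1/(1-t)

  t geometric : Series
  t zero    = 0ℚ
  t (suc k) = oneS k
  geometric _ = 1ℚ

  t⊛-suc : ∀ f k → (t ⊛ f) (suc k) ≡ f k
  t⊛-suc f k = trans (⊛-sucˡ t f k) (trans (≡.cong₂ _+_ (zeroˡ (f (suc k))) (⊛-identityˡ f k)) (+-identityˡ (f k)))

  euler-t : Derivation.⟦ euler ⟧ t S.≈ t
  euler-t = pointwise λ where
    zero          → refl
    (suc zero)    → refl
    (suc (suc k)) → trans (sym (×-comm-* (suc (suc k)) 0ℚ 1ℚ)) (zeroˡ (suc (suc k) ⨯ 1ℚ))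

  geometric-equation : geometric S.≈ S.1# S.+ t S.* geometric
  geometric-equation = pointwise λ where
    zero    → refl
    (suc k) → sym (trans (+-identityˡ _) (t⊛-suc geometric k))

  oneMinusT≈ : oneMinusT S.≈ S.1# S.- t
  oneMinusT≈ = pointwise λ where
    zero          → refl
    (suc zero)    → refl
    (suc (suc _)) → refl

  ^S≡^ : ∀ f e → f ^S e ≡ f S.^ e
  ^S≡^ f zero    = refl
  ^S≡^ f (suc e) = cong (f ⊛_) (^S≡^ f e)

  open DescentSeries.Geometric euler t geometric euler-t geometric-equation
  open BurgersSolution euler

  binomialSeries : ℕ → Series
  binomialSeries n m = (ℤ.+ ((m ℕ+ n) C m)) / 1

  -- Pascal's rule read as an equation x = y + t x, which `fixedPoint` solves; `geometric^` iterates
  -- this to obtain the series of 1/(1-t)^(n+1).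
  binomialSeries-pascal : ∀ n → binomialSeries (suc n) S.≈ binomialSeries n S.+ t S.* binomialSeries (suc n)
  binomialSeries-pascal n = pointwise coefficients
    where
    pascal : ∀ m → (suc m ℕ+ suc n) C suc m ≡ (suc m ℕ+ n) C suc m ℕ+ (m ℕ+ suc n) C m
    pascal m rewrite ℕ.+-suc m n =
      trans (sym (nCk+nC[k+1]≡[n+1]C[k+1] (suc (m ℕ+ n)) m)) (ℕ.+-comm (suc (m ℕ+ n) C m) _)
    coefficients : ∀ m → binomialSeries (suc n) m ≡ (binomialSeries n S.+ t S.* binomialSeries (suc n)) m
    coefficients zero    = sym (trans (cong (1ℚ +_) (trans (⊛-0 t (binomialSeries (suc n))) (zeroˡ (binomialSeries (suc n) 0)))) (+-identityʳ 1ℚ))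
    coefficients (suc m) = trans (cong (λ c → (ℤ.+ c) / 1) (pascal m))
      (trans (sym (/-homo-+ ((suc m ℕ+ n) C suc m) ((m ℕ+ suc n) C m) 0))
        (cong (binomialSeries n (suc m) +_) (sym (t⊛-suc (binomialSeries (suc n)) m))))

  geometric^ : ∀ n → geometric S.^ suc n S.≈ binomialSeries n
  geometric^ zero    = S.trans (S.*-identityʳ geometric)
    (pointwise λ m → sym (cong (λ c → (ℤ.+ c) / 1) (trans (cong (_C m) (ℕ.+-identityʳ m)) (nCn≡1 m))))
  geometric^ (suc n) = S.trans (S.*-congˡ {geometric} (geometric^ n))
    (S.sym (fixedPoint (binomialSeries (suc n)) (binomialSeries n) (binomialSeries-pascal n)))

  -- Comparison of coefficients

  t^-coeff : ∀ d k → (t S.^ d) k ≡ (if d ≡ᵇ k then 1ℚ else 0ℚ)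
  t^-coeff zero    zero    = refl
  t^-coeff zero    (suc k) = refl
  t^-coeff (suc d) zero    = trans (⊛-0 t (t S.^ d)) (zeroˡ ((t S.^ d) 0))
  t^-coeff (suc d) (suc k) = trans (t⊛-suc (t S.^ d) k) (t^-coeff d k)

  desSum-coeff : ∀ ws k → desSum ws k ≡ (ℤ.+ length (filterᵇ (λ w → des w ≡ᵇ k) ws)) / 1
  desSum-coeff []       k = refl
  desSum-coeff (w ∷ ws) k with des w ≡ᵇ k | t^-coeff (des w) k
  ... | true  | eq = trans (≡.cong₂ _+_ eq (desSum-coeff ws k)) (/-homo-+ 1 (length (filterᵇ (λ w → des w ≡ᵇ k) ws)) 0)
  ... | false | eq = trans (≡.cong₂ _+_ eq (desSum-coeff ws k)) (+-identityˡ _)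

  desSum-Qbar : ∀ n k → desSum (qs n (range n)) k ≡ Qbar n k
  desSum-Qbar n k = trans (desSum-coeff (qs n (range n)) k)
    (cong (λ l → (ℤ.+ l) / 1) (sym (↭-length (filter-↭ (T? ∘ λ w → des w ≡ᵇ k) (quasiStirling↭qs n)))))

  θ^-cong : ∀ n {f g} → f S.≈ g → θ^ n f S.≈ θ^ n g
  θ^-cong zero    eq = eq
  θ^-cong (suc n) eq = Derivation.⟦⟧-cong euler (θ^-cong n eq)

  θ^-coeff : ∀ n (c : ℕ → ℕ) m → θ^ n (λ i → (ℤ.+ c i) / 1) m ≡ (ℤ.+ (m ℕ^ n ℕ* c m)) / 1
  -- `m ℕ^ 0` is 1 for every `m`, also for `m = 0`: this is the convention 0⁰ = 1.
  θ^-coeff zero    c m = cong (λ x → (ℤ.+ x) / 1) (sym (ℕ.+-identityʳ (c m)))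
  θ^-coeff (suc n) c m = trans (cong (m ⨯_) (θ^-coeff n c m))
    (trans (⨯-/ m _ 0) (cong (λ x → (ℤ.+ x) / 1) (sym (ℕ.*-assoc m (m ℕ^ n) (c m)))))

  -- Multiplied by n+1, both sides become θⁿ applied to 1/(1-t)^(n+1): the left one by its
  -- coefficients, the right one by `burgers-solution`.
  lhsSeries≈u : ∀ n → lhsSeries n S.≈ u n
  lhsSeries≈u n = pointwise λ m → ⨯-cancel n (begin
    suc n ⨯ lhsSeries n m                          ≡⟨ ⨯-/-cancel n (m ℕ^ n ℕ* ((m ℕ+ n) C m)) ⟩
    (ℤ.+ (m ℕ^ n ℕ* ((m ℕ+ n) C m))) / 1           ≡⟨ θ^-coeff n (λ i → (i ℕ+ n) C i) m ⟨
    θ^ n (binomialSeries n) m                      ≡⟨ coeff (θ^-cong n (S.trans (S.^-congˡ (suc n) {u 0} {geometric} u-0) (geometric^ n))) m ⟨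
    θ^ n (u 0 S.^ suc n) m                         ≡⟨ coeff (burgers-solution ⨯-cancel-S u u-equation n) m ⟨
    (suc n S.⨯ u n) m                              ≡⟨ ⨯-coeff (suc n) (u n) m ⟩
    suc n ⨯ u n m                                  ∎)

  u-oneMinusT : ∀ n → u n S.* oneMinusT S.^ (2 ℕ* n ℕ+ 1) S.≈ desSum (qs n (range n))
  u-oneMinusT n rewrite length-range n | ℕ.+-comm (2 ℕ* n) 1 = S.trans (S.*-assoc d (geometric S.^ e) (oneMinusT S.^ e))
    (S.trans (S.*-congˡ {d} (g^-inverse oneMinusT≈ e)) (S.*-identityʳ d))
    where
    d = desSum (qs n (range n))
    e = suc (2 ℕ* n)

  lhsSeries-oneMinusT : ∀ n k → (lhsSeries n ⊛ (oneMinusT ^S (2 ℕ* n ℕ+ 1))) k ≡ Qbar n k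
  lhsSeries-oneMinusT n k = trans (cong (λ f → (lhsSeries n ⊛ f) k) (^S≡^ oneMinusT (2 ℕ* n ℕ+ 1)))
    (trans (coeff (S.*-congʳ {oneMinusT S.^ (2 ℕ* n ℕ+ 1)} (lhsSeries≈u n)) k)
      (trans (coeff (u-oneMinusT n) k) (desSum-Qbar n k)))

open import Data.Nat using (_+_; _*_)

theorem2p5 : (n k : ℕ) →
    (lhsSeries n ⊛ (oneMinusT ^S (2 * n + 1))) k ≡ Qbar n k
theorem2p5 = PowerSeries.lhsSeries-oneMinusT
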